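{- Let $k\ge 2$ and $n\ge 1$ be integers and let $T^n_k$ be the perfect $k$-ary tree of depth $n$. Then: \begin{itemize} \item for $n=1$, the paint cost spectrum of $T^n_k$ is $(k;\,k-1)$ and the paint cost ratio is $1$; \item for $n=2$, the paint cost spectrum of $T^n_k$ is $(k;\,k^2-1,\,k(k-1),\dots,k(k-1))$ (all entries after the entry $k^2-1$ equal $k(k-1)$), and the paint cost ratio is $\displaystyle\frac{k^2-2k+1}{k^2-2k+2}$; \item for $n\ge 3$, the paint cost spectrum of $T^n_k$ is $$(k;\;k^n-1,\;(k-1)(k^2+1)k^{n-3},\;k^{n-1}(k-1),\dots,k^{n-1}(k-1))$$ (all entries after the entry $(k-1)(k^2+1)k^{n-3}$ equal $k^{n-1}(k-1)$), and the paint cost ratio is $\displaystyle\frac{k^{n-1}(k-1)-k}{k^{n-1}(k-1)-k+2}$. \end{itemize}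
   Context: All graphs are finite and simple. For $k\ge 2$, $n\ge 1$, the perfect $k$-ary tree of depth $n$, denoted $T_k^n$, is the connected acyclic graph with $k^n$ leaves in which one vertex (the root) has degree $k$ and is at distance $n$ from every leaf, and all other internal (non-leaf) vertices have degree $k+1$. A coloring of the vertices of a graph $G$ with $d$ colors (a map from $V(G)$ to a set of $d$ colors, not required to use every color) is $d$-distinguishing if the only automorphism of $G$ preserving the color classes (i.e. mapping each color class to itself) is the trivial one. The distinguishing number $\operatorname{Dist}(G)$ is the smallest $d$ for which $G$ has a $d$-distinguishing coloring. For $d\ge \operatorname{Dist}(G)$, the paint cost of $d$-distinguishing $G$ (the $d$-paint cost), denoted $\rho^d(G)$, is the minimum size of the complement of a color class over all $d$-distinguishing colorings of $G$. A set $S\subseteq V(G)$ is a fixing set for $G$ if the only automorphism of $G$ that fixes every element of $S$ is the trivial one; the fixing number $\operatorname{Fix}(G)$ is the smallest cardinality of a fixing set. The frugal distinguishing number $\operatorname{Fdist}(G)$ is the smallest $d$ for which $\rho^d(G)=\operatorname{Fix}(G)$. The paint cost spectrum of $G$ is the list $$(\operatorname{Dist}(G);\ \rho^{\operatorname{Dist}(G)}(G),\ \rho^{\operatorname{Dist}(G)+1}(G),\ \dots,\ \rho^{\operatorname{Fix}(G)+1}(G)),$$ where the first entry is the distinguishing number and the remaining entries are the $d$-paint costs for $d=\operatorname{Dist}(G),\dots,\operatorname{Fix}(G)+1$. The paint cost ratio of $G$ is $$\frac{\operatorname{Fix}(G)-\operatorname{Fdist}(G)+2}{\operatorname{Fix}(G)-\operatorname{Dist}(G)+2}.$$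 -}

module Defs where

open import Data.Fin using (Fin)
import Data.Fin as Fin
open import Data.Fin.Permutation using (Permutation′; _⟨$⟩ʳ_)
open import Data.Fin.Subset using (Subset; _∈_; ∁; ∣_∣)
import Data.Integer as ℤ
open import Data.List using (List; []; _∷_; applyUpTo)
open import Data.List.Relation.Binary.Pointwise using (Pointwise)
open import Data.List.Relation.Unary.Unique.Propositional using (Unique)
open import Data.Nat using (ℕ; suc; _+_; _∸_; _^_; _≤_; _≟_; NonZero)
open import Data.Product using (∃-syntax; Σ-syntax; _×_)
open import Data.Rational using (ℚ; _/_)
open import Data.Vec using (tabulate)
open import Function using (_⇔_)
open import Relation.Binary.Definitions using (Symmetric; Irreflexive)
import Relation.Binary.Definitions as Binary
open import Relation.Binary.PropositionalEquality using (_≡_; _≢_)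
open import Relation.Nullary using (¬_; does)
open import Relation.Unary using (Decidable)

Least : (ℕ → Set) → ℕ → Set
Least P m = P m × (∀ j → P j → m ≤ j)

comprehension : ∀ {n} {P : Fin n → Set} → Decidable P → Subset n
comprehension P? = tabulate (λ v → does (P? v))

-- Finite simple graphs, on the vertex set Fin order.
record Graph : Set₁ where
  infix 4 _~_ _~?_
  field
    order    : ℕ
    _~_      : Fin order → Fin order → Set
    _~?_     : Binary.Decidable _~_
    ~-sym    : Symmetric _~_
    ~-irrefl : Irreflexive _≡_ _~_

  Vertex : Set
  Vertex = Fin order

module _ (G : Graph) where
  open Graph G

  degree : Vertex → ℕ
  degree v = ∣ comprehension (v ~?_) ∣

  Leaf : Vertex → Set
  Leaf v = degree v ≡ 1

  leaf? : Decidable Leaf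
  leaf? v = degree v ≟ 1

  leaves : Subset order
  leaves = comprehension leaf?

  data Walk : ℕ → Vertex → Vertex → Set where
    []  : ∀ {v} → Walk 0 v v
    _∷_ : ∀ {m u v w} → u ~ v → Walk m v w → Walk (suc m) u w

  vertices : ∀ {m u v} → Walk m u v → List Vertex
  vertices {u = u} []      = u ∷ []
  vertices {u = u} (_ ∷ p) = u ∷ vertices p

  Connected : Set
  Connected = ∀ u v → ∃[ m ] Walk m u v

  -- A cycle is a path with at least two edges together with an edge
  -- joining its endpoints.
  Acyclic : Set
  Acyclic = ∀ {m u v} (p : Walk m u v) → Unique (vertices p) → 2 ≤ m → ¬ (v ~ u)

  Distance : Vertex → Vertex → ℕ → Set
  Distance u v = Least (λ m → Walk m u v)

  record IsPerfectTree (k n : ℕ) : Set where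
    field
      connected       : Connected
      acyclic         : Acyclic
      leaf-count      : ∣ leaves ∣ ≡ k ^ n
      root            : Vertex
      root-degree     : degree root ≡ k
      leaf-depth      : ∀ v → Leaf v → Distance root v n
      internal-degree : ∀ v → v ≢ root → ¬ Leaf v → degree v ≡ suc k

  record Automorphism : Set where
    field
      permutation : Permutation′ order
      preserves-~ : ∀ u v → u ~ v ⇔ (permutation ⟨$⟩ʳ u) ~ (permutation ⟨$⟩ʳ v)

  open Automorphism

  infixr 10 _·_
  _·_ : Automorphism → Vertex → Vertex
  φ · v = permutation φ ⟨$⟩ʳ v

  Trivial : Automorphism → Set
  Trivial φ = ∀ v → φ · v ≡ v

  Coloring : ℕ → Set
  Coloring d = Vertex → Fin d

  colorClass : ∀ {d} → Coloring d → Fin d → Subset order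
  colorClass c i = comprehension (λ v → c v Fin.≟ i)

  PreservesColors : ∀ {d} → Coloring d → Automorphism → Set
  PreservesColors c φ = ∀ v → c (φ · v) ≡ c v

  Distinguishing : ∀ {d} → Coloring d → Set
  Distinguishing c = ∀ φ → PreservesColors c φ → Trivial φ

  -- The invariants below are given as relations: "IsDist d" reads
  -- "Dist(G) = d", and similarly for the others.

  IsDist : ℕ → Set
  IsDist = Least (λ d → Σ[ c ∈ Coloring d ] Distinguishing c)

  -- IsPaintCost d m : ρ^d(G) = m.  It forces d ≥ Dist(G), since the minimum
  -- has to be attained by some d-distinguishing coloring.
  IsPaintCost : ℕ → ℕ → Set
  IsPaintCost d = Least (λ m → Σ[ c ∈ Coloring d ]
    Distinguishing c × (∃[ i ] ∣ ∁ (colorClass c i) ∣ ≡ m))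

  Fixing : Subset order → Set
  Fixing S = ∀ φ → (∀ v → v ∈ S → φ · v ≡ v) → Trivial φ

  IsFix : ℕ → Set
  IsFix = Least (λ m → ∃[ S ] Fixing S × ∣ S ∣ ≡ m)

  IsFdist : ℕ → Set
  IsFdist = Least (λ d → ∃[ m ] IsPaintCost d m × IsFix m)

  -- The costs are those for d = dist , … , fix + 1, in this order.
  record IsPaintCostSpectrum (dist : ℕ) (costs : List ℕ) : Set where
    field
      {fix}   : ℕ
      isDist  : IsDist dist
      isFix   : IsFix fix
      isCosts : Pointwise IsPaintCost (applyUpTo (dist +_) (fix + 2 ∸ dist)) costs

  -- The denominator being nonzero means dist < fix + 2, so that the
  -- truncated subtraction there is a genuine one.
  record IsPaintCostRatio (q : ℚ) : Set where
    field
      {fix fdist dist} : ℕ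
      isFix            : IsFix fix
      isFdist          : IsFdist fdist
      isDist           : IsDist dist
      nonZero          : NonZero (fix + 2 ∸ dist)
      isRatio          : q ≡ _/_ (ℤ.+ fix ℤ.- ℤ.+ fdist ℤ.+ ℤ.+ 2) (fix + 2 ∸ dist) {{nonZero}}

module Submission where

-- An automorphism of the tree fixes the root, so a colouring c is distinguishing iff it is rigid:
-- every subtree is rigid and sibling subtrees are pairwise non-isomorphic as coloured trees.
-- Call the colours outside a chosen class paint.
--
-- Sibling leaves have different colours, so each of the k^(n-1) sets of sibling leaves has at
-- least k - 1 painted members.  This bounds every paint cost, and hence the fixing number, because
-- painting the vertices of a fixing set with pairwise different colours is distinguishing.
--
-- With k colours a rigid colouring of a subtree is determined up to isomorphism by the colour of
-- its root, so all sets of siblings carry all the colours.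
--
-- With k + 1 colours there is exactly one rigid colouring of depth 2 of the least cost k(k - 1):
-- each of the k sets of leaves omits a different painted colour.  So in every subtree of depth 3
-- all branches but one cost at least one more.  There are at least k + 1 colourings of depth 2
-- that cost exactly one more, hence k + 1 cheapest ones of depth 3, and from then on choosing
-- k of k + 1 non-isomorphic colourings of one depth yields k + 1 of the next at k times the cost.
--
-- With k + 2 colours there are already k + 1 cheapest colourings of depth 1.

open import Data.Bool using (Bool; true; false; not; if_then_else_)
open import Data.Fin using (Fin; zero; suc; _≟_; toℕ; punchIn; punchOut; inject≤; combine; remQuot; _↑ˡ_; _↑ʳ_)
open import Data.Fin.Permutation using (Permutation; Permutation′; permutation; _⟨$⟩ʳ_; _⟨$⟩ˡ_; inverseˡ; inverseʳ; flip; transpose)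
  renaming (id to idₚ)
open import Data.Fin.Properties using (any?; all?; ¬∀⟶∃¬; injective⇒≤; punchIn-injective; punchInᵢ≢i; punchOut-injective; punchIn-punchOut; suc-injective; inject≤-injective; combine-remQuot; remQuot-combine; toℕ-injective; toℕ<n)
open import Data.Fin.Subset using (Subset; _∈_; ∁; ∣_∣; inside; outside)
open import Data.Fin.Subset.Properties using (x∉p⇒x∈∁p)
import Data.Integer as ℤ
import Data.Integer.Tactic.RingSolver as ℤ-Solver
open import Data.List using ([]; _∷_; replicate; applyUpTo)
open import Data.List.Membership.DecPropositional using (_∈?_)
open import Data.List.Membership.Propositional using () renaming (_∈_ to _∈ₗ_)
open import Data.List.Relation.Binary.Pointwise using (Pointwise; []; _∷_)
open import Data.List.Relation.Unary.All as All using (All; []; _∷_)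
open import Data.List.Relation.Unary.All.Properties using (¬Any⇒All¬)
open import Data.List.Relation.Unary.AllPairs using ([]; _∷_)
open import Data.List.Relation.Unary.Any using (here; there)
open import Data.List.Relation.Unary.Unique.Propositional using (Unique)
open import Data.Nat using (ℕ; zero; suc; _+_; _*_; _∸_; _^_; _≤_; _<_; _≤?_; z≤n; s≤s; s≤s⁻¹; NonZero)
import Data.Nat as ℕ
open import Data.Nat.Properties hiding (_≟_; suc-injective)
import Data.Nat.Properties as ℕ
open import Data.Nat.Tactic.RingSolver using (solve-∀)
open import Data.Product using (∃-syntax; Σ-syntax; _×_; _,_; proj₁; proj₂)
open import Data.Rational using (1ℚ; _/_)
open import Data.Rational.Properties using (/-cong)
open import Data.Sum using (_⊎_; inj₁; inj₂)
open import Data.Vec using ([]; _∷_; here; there; lookup; tabulate)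
open import Data.Vec.Properties using (lookup∘tabulate; lookup⇒[]=; []=⇒lookup; tabulate-∘; tabulate-cong; tabulate∘lookup)
open import Function using (_∘_; Injective; mk⇔; Equivalence)
open import Relation.Binary.PropositionalEquality
open import Relation.Nullary using (¬_; yes; no; does; contradiction)
open import Relation.Nullary.Decidable using (dec-true; dec-false)
open import Relation.Unary using (Decidable)

open import Defs
open import Algebra.Properties.CommutativeMonoid.Sum +-0-commutativeMonoid using (sum; sum-permute; sum-cong-≗)

private variable
  k m n h d : ℕ
  C : Set

-- Finite sums

sum-const : ∀ n x → sum {n} (λ _ → x) ≡ n * x
sum-const zero    x = refl
sum-const (suc n) x = cong (x +_) (sum-const n x)

sum-≥ : ∀ {x} (f : Fin n → ℕ) → (∀ i → x ≤ f i) → n * x ≤ sum f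
sum-≥ {zero}  f x≤f = z≤n
sum-≥ {suc n} f x≤f = +-mono-≤ (x≤f zero) (sum-≥ (f ∘ suc) (x≤f ∘ suc))

-- A sum at its lower bound leaves no slack in any term. This pins down the cost of each star in a
-- cheapest colouring of depth 2.
sum-tight : ∀ {x} (f : Fin n → ℕ) → (∀ i → x ≤ f i) → sum f ≤ n * x → ∀ i → f i ≡ x
sum-tight {suc n} {x} f x≤f f≤ zero = ≤-antisym
  (+-cancelʳ-≤ (n * x) (f zero) x
    (≤-trans (+-monoʳ-≤ (f zero) (sum-≥ (f ∘ suc) (x≤f ∘ suc))) f≤))
  (x≤f zero)
sum-tight {suc n} {x} f x≤f f≤ (suc i) = sum-tight (f ∘ suc) (x≤f ∘ suc)
  (+-cancelˡ-≤ x (sum (f ∘ suc)) (n * x)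
    (≤-trans (+-monoˡ-≤ (sum (f ∘ suc)) (x≤f zero)) f≤)) i

-- All terms but one exceed the minimum, so n of them contribute at least one extra. In the lower
-- bounds, rigidity is what allows only one branch of least cost.
sum-one-minimal : ∀ {x} (f : Fin (suc n) → ℕ) → (∀ i → x ≤ f i) →
  (∀ {i j} → f i ≡ x → f j ≡ x → i ≡ j) → suc n * x + n ≤ sum f
sum-one-minimal {zero}  {x} f x≤f one =
  ≤-trans (≤-reflexive (+-identityʳ (x + 0))) (+-monoˡ-≤ 0 (x≤f zero))
sum-one-minimal {suc n} {x} f x≤f one with f zero ℕ.≟ x
... | yes f₀≡x = begin
  x + suc n * x + suc n   ≡⟨ +-assoc x (suc n * x) (suc n) ⟩
  x + (suc n * x + suc n) ≡⟨ cong (x +_) (+-comm (suc n * x) (suc n)) ⟩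
  x + (suc n + suc n * x) ≡⟨ cong (x +_) (*-suc (suc n) x) ⟨
  x + suc n * suc x       ≤⟨ +-mono-≤ (x≤f zero) (sum-≥ (f ∘ suc) above) ⟩
  sum f                   ∎
  where
  open ≤-Reasoning
  above : ∀ i → suc x ≤ f (suc i)
  above i = ≤∧≢⇒< (x≤f (suc i)) λ x≡ → contradiction (one f₀≡x (sym x≡)) λ ()
... | no f₀≢x = begin
  x + suc n * x + suc n     ≡⟨ +-assoc x (suc n * x) (suc n) ⟩
  x + (suc n * x + suc n)   ≡⟨ cong (x +_) (+-suc (suc n * x) n) ⟩
  x + suc (suc n * x + n)   ≡⟨ +-suc x _ ⟩
  suc x + (suc n * x + n)   ≤⟨ +-mono-≤ (≤∧≢⇒< (x≤f zero) (f₀≢x ∘ sym))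
                                 (sum-one-minimal (f ∘ suc) (x≤f ∘ suc)
                                   (λ p q → suc-injective (one p q))) ⟩
  sum f                     ∎
  where open ≤-Reasoning

sum-↑ : ∀ m (f : Fin (m + n) → ℕ) → sum f ≡ sum (f ∘ (_↑ˡ n)) + sum (f ∘ (m ↑ʳ_))
sum-↑ zero    f = refl
sum-↑ (suc m) f = trans (cong (f zero +_) (sum-↑ m (f ∘ suc))) (sym (+-assoc (f zero) _ _))

sum-combine : ∀ m (f : Fin (m * n) → ℕ) → sum f ≡ sum (λ i → sum (λ j → f (combine {m} i j)))
sum-combine         zero    f = refl
sum-combine {n = n} (suc m) f =
  trans (sum-↑ n f) (cong (sum (f ∘ (_↑ˡ (m * n))) +_) (sum-combine m (f ∘ (n ↑ʳ_))))

-- Maps between finite sets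

hits-or-misses : (f : Fin m → Fin n) → (∀ y → ∃[ x ] f x ≡ y) ⊎ (∃[ y ] (∀ x → f x ≢ y))
hits-or-misses f with all? (λ y → any? (λ x → f x ≟ y))
... | yes hits = inj₁ hits
... | no ¬hits with y , ¬hit ← ¬∀⟶∃¬ _ _ (λ y → any? (λ x → f x ≟ y)) ¬hits =
  inj₂ (y , λ x fx≡y → ¬hit (x , fx≡y))

section-injective : {f : Fin m → Fin n} (hits : ∀ y → ∃[ x ] f x ≡ y) →
  Injective _≡_ _≡_ (proj₁ ∘ hits)
section-injective {f = f} hits {x} {y} eq =
  trans (sym (proj₂ (hits x))) (trans (cong f eq) (proj₂ (hits y)))

-- If y were missed, `punchOut` at y would inject n points into n - 1.
injective⇒hits : (f : Fin n → Fin n) → Injective _≡_ _≡_ f → ∀ y → ∃[ x ] f x ≡ y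
injective⇒hits {n} f inj with hits-or-misses f
... | inj₁ hits = hits
injective⇒hits {suc n} f inj | inj₂ (y , misses) =
  contradiction (injective⇒≤ λ {a} {b} eq → inj (punchOut-injective (≢y a) (≢y b) eq)) (<⇒≱ ≤-refl)
  where
  ≢y : ∀ x → y ≢ f x
  ≢y x = misses x ∘ sym

injective⇒permutation : (f : Fin n → Fin n) → Injective _≡_ _≡_ f →
  Σ[ π ∈ Permutation′ n ] (∀ i → π ⟨$⟩ʳ i ≡ f i)
injective⇒permutation f inj =
  permutation f (proj₁ ∘ hits) (proj₂ ∘ hits) (λ x → inj (proj₂ (hits (f x)))) , λ _ → refl
  where hits = injective⇒hits f inj

misses : ∀ (f : Fin n → Fin (suc n)) → ∃[ y ] (∀ x → f x ≢ y)
misses f with hits-or-misses f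
... | inj₁ hits = contradiction (injective⇒≤ (section-injective hits)) (<⇒≱ ≤-refl)
... | inj₂ miss = miss

-- Two injections of n points into n + 1 that miss the same point z have the same image. Punching
-- out z turns g into an injective, hence surjective, self-map that can be solved for each value of
-- f.
rearrange : (f g : Fin n → Fin (suc n)) → Injective _≡_ _≡_ f → Injective _≡_ _≡_ g →
  ∀ {z} → (∀ x → f x ≢ z) → (∀ x → g x ≢ z) →
  Σ[ π ∈ Permutation′ n ] (∀ i → g (π ⟨$⟩ʳ i) ≡ f i)
rearrange f g f-inj g-inj {z} f≢z g≢z = proj₁ p , λ i → trans (cong g (proj₂ p i)) (match-eq i)
  where
  z≢g : ∀ x → z ≢ g x
  z≢g x = g≢z x ∘ sym
  z≢f : ∀ x → z ≢ f x
  z≢f x = f≢z x ∘ sym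
  match : ∀ i → ∃[ x ] punchOut (z≢g x) ≡ punchOut (z≢f i)
  match i = injective⇒hits (λ x → punchOut (z≢g x))
    (λ {a} {b} eq → g-inj (punchOut-injective (z≢g a) (z≢g b) eq)) (punchOut (z≢f i))
  match-eq : ∀ i → g (proj₁ (match i)) ≡ f i
  match-eq i = punchOut-injective (z≢g _) (z≢f i) (proj₂ (match i))
  p = injective⇒permutation (proj₁ ∘ match) λ {a} {b} eq →
    f-inj (trans (sym (match-eq a)) (trans (cong g eq) (match-eq b)))

-- The perfect tree: positions and automorphisms

data Position (k : ℕ) : ℕ → Set where
  root : Position k h
  sub  : Fin k → Position k h → Position k (suc h)

data Parent {k : ℕ} : Position k h → Position k h → Set where
  root : ∀ i → Parent {h = suc h} root (sub i root)
  sub  : ∀ i {p q : Position k h} → Parent p q → Parent (sub i p) (sub i q)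

-- The automorphism group as an iterated wreath product of symmetric groups: each branch is first
-- moved within itself, then carried to its new place.
data TreeAut (k : ℕ) : ℕ → Set where
  leaf : TreeAut k 0
  node : Permutation′ k → (Fin k → TreeAut k h) → TreeAut k (suc h)

act : TreeAut k h → Position k h → Position k h
act a           root      = root
act (node π as) (sub i p) = sub (π ⟨$⟩ʳ i) (act (as i) p)

inverse : TreeAut k h → TreeAut k h
inverse leaf        = leaf
inverse (node π as) = node (flip π) (λ i → inverse (as (π ⟨$⟩ˡ i)))

identity : ∀ h → TreeAut k h
identity zero    = leaf
identity (suc h) = node idₚ (λ _ → identity h)

act-identity : (p : Position k h) → act (identity h) p ≡ p
act-identity root      = refl
act-identity (sub i p) = cong (sub i) (act-identity p)

act-inverseˡ : (a : TreeAut k h) (p : Position k h) → act (inverse a) (act a p) ≡ p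
act-inverseˡ a           root      = refl
act-inverseˡ (node π as) (sub i p) rewrite inverseˡ π {i} = cong (sub i) (act-inverseˡ (as i) p)

act-inverseʳ : (a : TreeAut k h) (p : Position k h) → act a (act (inverse a) p) ≡ p
act-inverseʳ a           root      = refl
act-inverseʳ (node π as) (sub i p) = cong₂ sub (inverseʳ π) (act-inverseʳ (as (π ⟨$⟩ˡ i)) p)

act-Parent : (a : TreeAut k h) {p q : Position k h} → Parent p q → Parent (act a p) (act a q)
act-Parent (node π as) (root i)  = root (π ⟨$⟩ʳ i)
act-Parent (node π as) (sub i e) = sub (π ⟨$⟩ʳ i) (act-Parent (as i) e)

sub-injectiveˡ : ∀ {i j} {p q : Position k h} → sub i p ≡ sub j q → i ≡ j
sub-injectiveˡ refl = refl

sub-injectiveʳ : ∀ {i j} {p q : Position k h} → sub i p ≡ sub j q → p ≡ q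
sub-injectiveʳ refl = refl

-- Rigid colourings of the perfect tree

Preserves : (Position k h → C) → TreeAut k h → Set
Preserves c a = ∀ p → c (act a p) ≡ c p

-- Triviality is asked of the action, since a `TreeAut` contains functions and propositional
-- equality of those is too fine.
Rigid : (Position k h → C) → Set
Rigid {k} {h} c = (a : TreeAut k h) → Preserves c a → ∀ p → act a p ≡ p

record Similar {k h : ℕ} {C : Set} (c c′ : Position k h → C) : Set where
  constructor _,_
  field
    aut      : TreeAut k h
    preserve : ∀ p → c′ (act aut p) ≡ c p

open Similar

Distinct : (Fin m → Position k h → C) → Set
Distinct F = ∀ {i j} → Similar (F i) (F j) → i ≡ j

Similar-sym : {c c′ : Position k h → C} → Similar c c′ → Similar c′ c
Similar-sym {c′ = c′} (a , eq) =
  inverse a , λ p → trans (sym (eq (act (inverse a) p))) (cong c′ (act-inverseʳ a p))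

Similar-root : {c c′ : Position k h → C} → Similar c c′ → c root ≡ c′ root
Similar-root (a , eq) = sym (eq root)

Similar-node : {c c′ : Position k (suc h) → C} → c root ≡ c′ root → (π : Permutation′ k) →
  (∀ i → Similar (c ∘ sub i) (c′ ∘ sub (π ⟨$⟩ʳ i))) → Similar c c′
Similar-node r≡r′ π s = node π (aut ∘ s) , λ where
  root      → sym r≡r′
  (sub i p) → preserve (s i) p

-- A symmetry of one branch extends by the identity on the other branches.
rigid-sub : (c : Position k (suc h) → C) → Rigid c → ∀ i → Rigid (c ∘ sub i)
rigid-sub {k} {h} c rigid i a pres p = sub-injectiveʳ (trans (sym onᵢ) (rigid b b-pres (sub i p)))
  where
  as : Fin k → TreeAut k h
  as j = if does (j ≟ i) then a else identity h
  b : TreeAut k (suc h)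
  b = node idₚ as
  b-pres : Preserves c b
  b-pres root      = refl
  b-pres (sub j q) with j ≟ i
  ... | yes refl = pres q
  ... | no  _    = cong (c ∘ sub j) (act-identity q)
  onᵢ : act b (sub i p) ≡ sub i (act a p)
  onᵢ rewrite dec-true (i ≟ i) refl = refl

-- An isomorphism between branches i and j, used one way and inverted the other way, gives a
-- colour-preserving swap of the two; rigidity makes the swap trivial.
rigid-distinct : (c : Position k (suc h) → C) → Rigid c → Distinct (λ i → c ∘ sub i)
rigid-distinct {k} {h} c rigid {i} {j} (a , eq) =
  sym (trans (sym onᵢ) (sub-injectiveˡ (rigid b b-pres (sub i root))))
  where
  as : Fin k → TreeAut k h
  -- The tests come in the order in which `transpose i j` makes them, so one case split evaluates
  -- both.
  as l = if does (l ≟ i) then a else if does (l ≟ j) then inverse a else identity h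
  b : TreeAut k (suc h)
  b = node (transpose i j) as
  b-pres : Preserves c b
  b-pres root      = refl
  b-pres (sub l q) with l ≟ i
  ... | yes refl = eq q
  ... | no  _    with l ≟ j
  ...   | yes refl = preserve (Similar-sym {c = c ∘ sub i} {c ∘ sub j} (a , eq)) q
  ...   | no  _    = cong (c ∘ sub l) (act-identity q)
  onᵢ : transpose i j ⟨$⟩ʳ i ≡ j
  onᵢ rewrite dec-true (i ≟ i) refl = refl

rigid-leaf : (c : Position k 0 → C) → Rigid c
rigid-leaf c a pres root = refl

-- The permutation at the root fixes every index, because the automorphism itself witnesses that
-- branch i is similar to branch π i.
rigid-node : (c : Position k (suc h) → C) → (∀ i → Rigid (c ∘ sub i)) →
  Distinct (λ i → c ∘ sub i) → Rigid c
rigid-node c rigid distinct a           pres root      = refl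
rigid-node c rigid distinct (node π as) pres (sub i p) =
  cong₂ sub (πi≡i i) (rigid i (as i) pres′ p)
  where
  πi≡i : ∀ i → π ⟨$⟩ʳ i ≡ i
  πi≡i i = sym (distinct (as i , λ q → pres (sub i q)))
  pres′ : Preserves (c ∘ sub i) (as i)
  pres′ q = trans (cong (λ j → c (sub j (act (as i) q))) (sym (πi≡i i))) (pres (sub i q))

-- Paint costs: lower bounds

total : (Position k h → ℕ) → ℕ
total {h = zero}  g = g root
total {h = suc h} g = g root + sum (λ i → total (g ∘ sub i))

mismatch : Fin d → Fin d → ℕ
mismatch i c = if does (c ≟ i) then 0 else 1

-- The size of the complement of colour class i, as `paint-size` confirms for the graph.
cost : Fin d → (Position k h → Fin d) → ℕ
cost i c = total (mismatch i ∘ c)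

mismatch≡0⇒≡ : {i c : Fin d} → mismatch i c ≡ 0 → c ≡ i
mismatch≡0⇒≡ {i = i} {c} eq with c ≟ i
... | yes c≡i = c≡i

≢⇒mismatch≡1 : {i c : Fin d} → c ≢ i → mismatch i c ≡ 1
≢⇒mismatch≡1 {i = i} {c} c≢i rewrite dec-false (c ≟ i) c≢i = refl

sum≤cost : (i : Fin d) (c : Position k (suc h) → Fin d) → sum (λ j → cost i (c ∘ sub j)) ≤ cost i c
sum≤cost i c = m≤n+m _ (mismatch i (c root))

Similar-leaf : {c c′ : Position k 0 → C} → c root ≡ c′ root → Similar c c′
Similar-leaf eq = leaf , λ { root → sym eq }

leaves-injective : (c : Position k 1 → C) → Rigid c → Injective _≡_ _≡_ (λ j → c (sub j root))
leaves-injective c rigid eq = rigid-distinct c rigid (Similar-leaf eq)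

module _ {k₁ : ℕ} where

  private
    k′ = suc k₁

  rigid⇒k≤colours : ∀ h (c : Position k′ (suc h) → Fin d) → Rigid c → k′ ≤ d
  rigid⇒k≤colours zero    c rigid = injective⇒≤ (leaves-injective c rigid)
  rigid⇒k≤colours (suc h) c rigid = rigid⇒k≤colours h (c ∘ sub zero) (rigid-sub c rigid zero)

  -- Only leaves are counted: among siblings at most one has colour i. The number of colours is
  -- arbitrary, so the bound also applies to the fixing number.
  rigid⇒cost≥ : ∀ h (i : Fin d) (c : Position k′ (suc h) → Fin d) → Rigid c →
    k′ ^ h * k₁ ≤ cost i c
  rigid⇒cost≥ zero i c rigid = begin
    k₁ + 0                                    ≡⟨ +-comm k₁ 0 ⟩
    k₁                                        ≡⟨ cong (_+ k₁) (*-zeroʳ k′) ⟨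
    k′ * 0 + k₁                               ≤⟨ sum-one-minimal (λ j → cost i (c ∘ sub j)) (λ _ → z≤n)
      (λ p q → leaves-injective c rigid (trans (mismatch≡0⇒≡ p) (sym (mismatch≡0⇒≡ q)))) ⟩
    sum (λ j → cost i (c ∘ sub j))            ≤⟨ sum≤cost i c ⟩
    cost i c                                  ∎
    where open ≤-Reasoning
  rigid⇒cost≥ (suc h) i c rigid = begin
    k′ * k′ ^ h * k₁               ≡⟨ *-assoc k′ (k′ ^ h) k₁ ⟩
    k′ * (k′ ^ h * k₁)             ≤⟨ sum-≥ (λ j → cost i (c ∘ sub j))
                                        (λ j → rigid⇒cost≥ h i (c ∘ sub j) (rigid-sub c rigid j)) ⟩
    sum (λ j → cost i (c ∘ sub j)) ≤⟨ sum≤cost i c ⟩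
    cost i c                       ∎
    where open ≤-Reasoning

  -- With k colours a rigid colouring uses every colour on each set of siblings,
  -- so up to similarity only the colour of the root is free.
  mutual
    k-colours-Similar : ∀ h (c c′ : Position k′ h → Fin k′) → Rigid c → Rigid c′ →
      c root ≡ c′ root → Similar c c′
    k-colours-Similar zero    c c′ rigid rigid′ eq = Similar-leaf eq
    k-colours-Similar (suc h) c c′ rigid rigid′ eq =
      Similar-node eq (proj₁ ρ) λ i → let j = proj₁ ρ ⟨$⟩ʳ i in
        k-colours-Similar h (c ∘ sub i) (c′ ∘ sub j)
          (rigid-sub c rigid i) (rigid-sub c′ rigid′ j) (sym (suc-injective (proj₂ ρ i)))
      where
      -- Shifting the k colours by `suc` frees `zero` as the common missed value that `rearrange`
      -- expects.
      ρ = rearrange (λ j → suc (c (sub j root))) (λ j → suc (c′ (sub j root)))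
            (siblings-injective h c rigid ∘ suc-injective)
            (siblings-injective h c′ rigid′ ∘ suc-injective)
            {zero} (λ _ ()) (λ _ ())

    siblings-injective : ∀ h (c : Position k′ (suc h) → Fin k′) → Rigid c →
      Injective _≡_ _≡_ (λ j → c (sub j root))
    siblings-injective h c rigid {i} {j} eq = rigid-distinct c rigid
      (k-colours-Similar h (c ∘ sub i) (c ∘ sub j) (rigid-sub c rigid i) (rigid-sub c rigid j) eq)

  suc-pred-power : ∀ h → ∃[ x ] suc x ≡ k′ ^ h
  suc-pred-power h with k′ ^ h | m^n>0 k′ h
  ... | suc x | _ = x , refl

  -- The least cost is k ^ h - 1 for a root of colour i and k ^ h for a painted root; `suc` on the
  -- right avoids the subtraction. Since siblings differ in colour, only one branch can have the
  -- smaller cost.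
  k-colours-cost≥ : ∀ h (i : Fin k′) (c : Position k′ h → Fin k′) → Rigid c →
    k′ ^ h + mismatch i (c root) ≤ suc (cost i c)
  k-colours-cost≥ zero    i c rigid = ≤-refl
  k-colours-cost≥ (suc h) i c rigid with x , eq ← suc-pred-power h = begin
    k′ * k′ ^ h + r       ≡⟨ cong (λ y → k′ * y + r) eq ⟨
    k′ * suc x + r        ≡⟨ cong (_+ r) (trans (*-suc k′ x) (+-comm k′ (k′ * x))) ⟩
    k′ * x + k′ + r       ≡⟨ cong (_+ r) (+-suc (k′ * x) k₁) ⟩
    suc (k′ * x + k₁) + r ≤⟨ s≤s (+-monoˡ-≤ r (sum-one-minimal f (λ j → ≤-trans (m≤m+n x _) (x≤ j)) one)) ⟩
    suc (sum f) + r       ≡⟨ cong suc (+-comm (sum f) r) ⟩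
    suc (cost i c)        ∎
    where
    open ≤-Reasoning
    r = mismatch i (c root)
    f : Fin k′ → ℕ
    f j = cost i (c ∘ sub j)
    x≤ : ∀ j → x + mismatch i (c (sub j root)) ≤ f j
    x≤ j = s≤s⁻¹ (≤-trans (≤-reflexive (cong (_+ mismatch i (c (sub j root))) eq))
      (k-colours-cost≥ h i (c ∘ sub j) (rigid-sub c rigid j)))
    -- A branch of cost x leaves no room for a painted root.
    minimal⇒i : ∀ {j} → f j ≡ x → c (sub j root) ≡ i
    minimal⇒i {j} fj≡x = mismatch≡0⇒≡ (n≤0⇒n≡0 (+-cancelˡ-≤ x _ 0
      (≤-trans (x≤ j) (≤-reflexive (trans fj≡x (sym (+-identityʳ x)))))))
    one : ∀ {a b} → f a ≡ x → f b ≡ x → a ≡ b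
    one p q = siblings-injective h c rigid (trans (minimal⇒i p) (sym (minimal⇒i q)))

  -- With k + 1 colours the k leaves omit exactly one colour, so a rigid star is determined by its
  -- root colour and the omitted colour.
  star-Similar : (c c′ : Position k′ 1 → Fin (suc k′)) → Rigid c → Rigid c′ → c root ≡ c′ root →
    ∀ {z} → (∀ j → c (sub j root) ≢ z) → (∀ j → c′ (sub j root) ≢ z) → Similar c c′
  star-Similar c c′ rigid rigid′ eq c≢z c′≢z =
    Similar-node eq (proj₁ ρ) (λ j → Similar-leaf (sym (proj₂ ρ j)))
    where
    ρ = rearrange (λ j → c (sub j root)) (λ j → c′ (sub j root))
          (leaves-injective c rigid) (leaves-injective c′ rigid′) c≢z c′≢z

  -- Otherwise all k leaves are painted, which exceeds k - 1.
  cheap-star-uses : (i : Fin d) (c : Position k′ 1 → Fin d) → cost i c ≡ k₁ →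
    ∃[ j ] c (sub j root) ≡ i
  cheap-star-uses i c cost≡ with any? (λ j → c (sub j root) ≟ i)
  ... | yes hit = hit
  ... | no ¬hit = contradiction k′≤k₁ (<⇒≱ ≤-refl)
    where
    open ≤-Reasoning
    k′≤k₁ : k′ ≤ k₁
    k′≤k₁ = begin
      k′                                       ≡⟨ *-identityʳ k′ ⟨
      k′ * 1                                   ≡⟨ sum-const k′ 1 ⟨
      sum {k′} (λ _ → 1)                       ≡⟨ sum-cong-≗ {k′} (λ j → ≢⇒mismatch≡1 (λ eq → ¬hit (j , eq))) ⟨
      sum (λ j → mismatch i (c (sub j root))) ≤⟨ sum≤cost i c ⟩
      cost i c                                 ≡⟨ cost≡ ⟩
      k₁                                       ∎

  -- The bound k * k₁ is spent entirely on leaves. So no vertex above them is painted and each star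
  -- has a leaf of colour i, whence its omitted colour is not i.
  module CheapDepth2 (i : Fin (suc k′)) (c : Position k′ 2 → Fin (suc k′)) (rigid : Rigid c)
                     (cheap : cost i c ≤ k′ * k₁) where

    private
      f : Fin k′ → ℕ
      f j = cost i (c ∘ sub j)

      k₁≤f : ∀ j → k₁ ≤ f j
      k₁≤f j = subst (_≤ f j) (*-identityˡ k₁) (rigid⇒cost≥ 0 i (c ∘ sub j) (rigid-sub c rigid j))

      star-cost : ∀ j → f j ≡ k₁
      star-cost = sum-tight f k₁≤f (≤-trans (sum≤cost i c) cheap)

    root-unpainted : c root ≡ i
    root-unpainted = mismatch≡0⇒≡ (n≤0⇒n≡0 (+-cancelʳ-≤ (k′ * k₁) _ 0
      (≤-trans (+-monoʳ-≤ (mismatch i (c root)) (sum-≥ f k₁≤f)) cheap)))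

    star-root-unpainted : ∀ j → c (sub j root) ≡ i
    star-root-unpainted j = mismatch≡0⇒≡ (n≤0⇒n≡0 (+-cancelʳ-≤ k₁ _ 0 (begin
      r + k₁  ≤⟨ +-monoʳ-≤ r (≤-trans (≤-reflexive (cong (_+ k₁) (sym (*-zeroʳ k′))))
                   (sum-one-minimal (λ l → mismatch i (c (sub j (sub l root)))) (λ _ → z≤n)
                     (λ p q → leaves-injective (c ∘ sub j) (rigid-sub c rigid j)
                       (trans (mismatch≡0⇒≡ p) (sym (mismatch≡0⇒≡ q)))))) ⟩
      f j     ≡⟨ star-cost j ⟩
      k₁      ∎)))
      where
      open ≤-Reasoning
      r = mismatch i (c (sub j root))

    missing : Fin k′ → Fin (suc k′)
    missing j = proj₁ (misses (λ l → c (sub j (sub l root))))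

    missing-≢ : ∀ j l → c (sub j (sub l root)) ≢ missing j
    missing-≢ j = proj₂ (misses (λ l → c (sub j (sub l root))))

    missing≢i : ∀ j → missing j ≢ i
    missing≢i j eq with l , hit ← cheap-star-uses i (c ∘ sub j) (star-cost j) =
      missing-≢ j l (trans hit (sym eq))

    missing-injective : Injective _≡_ _≡_ missing
    missing-injective {a} {b} eq = rigid-distinct c rigid
      (star-Similar (c ∘ sub a) (c ∘ sub b) (rigid-sub c rigid a) (rigid-sub c rigid b)
        (trans (star-root-unpainted a) (sym (star-root-unpainted b)))
        (missing-≢ a) (λ l → missing-≢ b l ∘ λ q → trans q eq))

  -- In both colourings the k omitted colours are pairwise different and differ from i, so they
  -- exhaust the other k colours; stars with the same omitted colour are matched.
  cheap-depth-2-Similar : (i : Fin (suc k′)) (c c′ : Position k′ 2 → Fin (suc k′)) →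
    Rigid c → Rigid c′ → cost i c ≤ k′ * k₁ → cost i c′ ≤ k′ * k₁ → Similar c c′
  cheap-depth-2-Similar i c c′ rigid rigid′ cheap cheap′ =
    Similar-node (trans A.root-unpainted (sym B.root-unpainted)) (proj₁ ρ) λ j → let j′ = proj₁ ρ ⟨$⟩ʳ j in
      star-Similar (c ∘ sub j) (c′ ∘ sub j′) (rigid-sub c rigid j) (rigid-sub c′ rigid′ j′)
        (trans (A.star-root-unpainted j) (sym (B.star-root-unpainted j′)))
        (A.missing-≢ j) (λ l q → B.missing-≢ j′ l (trans q (sym (proj₂ ρ j))))
    where
    module A = CheapDepth2 i c rigid cheap
    module B = CheapDepth2 i c′ rigid′ cheap′
    ρ = rearrange A.missing B.missing A.missing-injective B.missing-injective A.missing≢i B.missing≢i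

  -- At depth 3 only one branch can cost k * k₁, so the other k₁ branches add one each. Greater
  -- depths merely multiply by k.
  k+1-colours-cost≥ : ∀ m (i : Fin (suc k′)) (c : Position k′ (m + 3) → Fin (suc k′)) → Rigid c →
    k′ ^ m * (k′ * (k′ * k₁) + k₁) ≤ cost i c
  k+1-colours-cost≥ zero i c rigid = begin
    k′ * (k′ * k₁) + k₁ + 0        ≡⟨ +-identityʳ _ ⟩
    k′ * (k′ * k₁) + k₁            ≤⟨ sum-one-minimal (λ j → cost i (c ∘ sub j)) cost≥
      (λ {a} {b} p q → rigid-distinct c rigid (cheap-depth-2-Similar i _ _
        (rigid-sub c rigid a) (rigid-sub c rigid b) (≤-reflexive p) (≤-reflexive q))) ⟩
    sum (λ j → cost i (c ∘ sub j)) ≤⟨ sum≤cost i c ⟩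
    cost i c                       ∎
    where
    open ≤-Reasoning
    cost≥ : ∀ j → k′ * k₁ ≤ cost i (c ∘ sub j)
    cost≥ j = subst (λ x → x * k₁ ≤ cost i (c ∘ sub j)) (*-identityʳ k′)
      (rigid⇒cost≥ 1 i (c ∘ sub j) (rigid-sub c rigid j))
  k+1-colours-cost≥ (suc m) i c rigid = begin
    k′ * k′ ^ m * x                ≡⟨ *-assoc k′ (k′ ^ m) x ⟩
    k′ * (k′ ^ m * x)              ≤⟨ sum-≥ (λ j → cost i (c ∘ sub j))
                                        (λ j → k+1-colours-cost≥ m i (c ∘ sub j) (rigid-sub c rigid j)) ⟩
    sum (λ j → cost i (c ∘ sub j)) ≤⟨ sum≤cost i c ⟩
    cost i c                       ∎
    where
    open ≤-Reasoning
    x = k′ * (k′ * k₁) + k₁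

-- Paint costs: economical colourings

record Family (k h : ℕ) (C : Set) (m : ℕ) : Set where
  field
    member   : Fin m → Position k h → C
    rigid    : ∀ i → Rigid (member i)
    distinct : Distinct member

open Family

paint : C → (Fin k → Position k h → C) → Position k (suc h) → C
paint r cs root      = r
paint r cs (sub i p) = cs i p

leafFamily : (ι : Fin m → C) → Injective _≡_ _≡_ ι → Family k 0 C m
leafFamily ι inj = record
  { member   = λ i _ → ι i
  ; rigid    = λ i → rigid-leaf _
  ; distinct = λ s → inj (Similar-root s)
  }

module _ (F : Family k h C m) where

  paint-rigid : ∀ r (s : Fin k → Fin m) → Injective _≡_ _≡_ s → Rigid (paint r (member F ∘ s))
  paint-rigid r s inj = rigid-node _ (rigid F ∘ s) (inj ∘ distinct F)

  -- A similarity carries branches to similar branches, and similar members of a family have the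
  -- same index. One inclusion suffices to separate choices of equally many branches.
  paint-Similar⇒⊆ : ∀ {r r′} {s s′ : Fin k → Fin m} →
    Similar (paint r (member F ∘ s)) (paint r′ (member F ∘ s′)) → ∀ l → ∃[ l′ ] s′ l′ ≡ s l
  paint-Similar⇒⊆ (node π as , eq) l =
    π ⟨$⟩ʳ l , sym (distinct F (as l , λ p → eq (sub l p)))

-- Member i has branch j for each j other than i, while member j lacks it; this separates the
-- members. The root has the unpainted colour `zero` and adds no cost.
omit : Family k h (Fin (suc d)) (suc k) → Family k (suc h) (Fin (suc d)) (suc k)
omit F = record
  { member   = λ j → paint zero (member F ∘ punchIn j)
  ; rigid    = λ j → paint-rigid F zero (punchIn j) (punchIn-injective j _ _)
  ; distinct = omit-distinct
  }
  where
  omit-distinct : Distinct (λ j → paint zero (member F ∘ punchIn j))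
  omit-distinct {i} {j} s with i ≟ j
  ... | yes i≡j = i≡j
  ... | no  i≢j with l , eq ← paint-Similar⇒⊆ F s (punchOut i≢j) =
    contradiction (trans eq (punchIn-punchOut i≢j)) (punchInᵢ≢i j l)

-- omit₂ j ranges over Fin (3 + n) without j and turn j.  Since turn moves every point and
-- is nowhere an involution, the pairs {j , turn j} are pairwise different.
turn : Fin (3 + n) → Fin (3 + n)
turn zero          = suc zero
turn (suc zero)    = suc (suc zero)
turn (suc (suc _)) = zero

j≢turn : (j : Fin (3 + n)) → j ≢ turn j
j≢turn zero          ()
j≢turn (suc zero)    ()
j≢turn (suc (suc _)) ()

j≢turn-turn : (j : Fin (3 + n)) → j ≢ turn (turn j)
j≢turn-turn zero          ()
j≢turn-turn (suc zero)    ()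
j≢turn-turn (suc (suc _)) ()

omit₂ : Fin (3 + n) → Fin (1 + n) → Fin (3 + n)
omit₂ j = punchIn j ∘ punchIn (punchOut (j≢turn j))

omit₂-injective : (j : Fin (3 + n)) → Injective _≡_ _≡_ (omit₂ j)
omit₂-injective j eq =
  punchIn-injective (punchOut (j≢turn j)) _ _ (punchIn-injective j _ _ eq)

omit₂≢j : (j : Fin (3 + n)) → ∀ l → omit₂ j l ≢ j
omit₂≢j j l = punchInᵢ≢i j _

omit₂≢turn : (j : Fin (3 + n)) → ∀ l → omit₂ j l ≢ turn j
omit₂≢turn j l eq = punchInᵢ≢i (punchOut (j≢turn j)) l
  (punchIn-injective j _ _ (trans eq (sym (punchIn-punchOut (j≢turn j)))))

omit₂-hits : ∀ {i j : Fin (3 + n)} → j ≢ i → turn j ≢ i → ∃[ l ] omit₂ j l ≡ i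
omit₂-hits {j = j} j≢i t≢i =
  punchOut p≢ , trans (cong (punchIn j) (punchIn-punchOut p≢)) (punchIn-punchOut j≢i)
  where
  p≢ : punchOut (j≢turn j) ≢ punchOut j≢i
  p≢ = t≢i ∘ punchOut-injective (j≢turn j) j≢i

-- For i different from j, the choice of i contains j, or, if j is `turn i`, it contains `turn j`.
-- The choice of j contains neither.
omit₂-⊆⇒≡ : ∀ {i j : Fin (3 + n)} → (∀ l → ∃[ l′ ] omit₂ j l′ ≡ omit₂ i l) → i ≡ j
omit₂-⊆⇒≡ {i = i} {j} ⊆ with i ≟ j
... | yes i≡j = i≡j
... | no  i≢j with turn i ≟ j
...   | no  t≢j with l , eq ← omit₂-hits i≢j t≢j with l′ , eq′ ← ⊆ l =
  contradiction (trans eq′ eq) (omit₂≢j j l′)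
...   | yes refl with l , eq ← omit₂-hits (j≢turn-turn i) (j≢turn (turn i)) with l′ , eq′ ← ⊆ l =
  contradiction (trans eq′ eq) (omit₂≢turn (turn i) l′)

-- With k = 2 + n, this takes the cheapest colouring, at index `zero`, and k - 1 of k + 1 others of
-- equal cost. As j varies, k + 1 selections of the same cost result.
keep-first : Fin (3 + n) → Fin (2 + n) → Fin (4 + n)
keep-first j zero    = zero
keep-first j (suc l) = suc (omit₂ j l)

keep-first-injective : (j : Fin (3 + n)) → Injective _≡_ _≡_ (keep-first j)
keep-first-injective j {zero}  {zero}  eq = refl
keep-first-injective j {suc _} {suc _} eq = cong suc (omit₂-injective j (suc-injective eq))

keep-first-⊆⇒≡ : ∀ {i j : Fin (3 + n)} →
  (∀ l → ∃[ l′ ] keep-first j l′ ≡ keep-first i l) → i ≡ j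
keep-first-⊆⇒≡ {i = i} {j} ⊆ = omit₂-⊆⇒≡ tail-⊆
  where
  tail-⊆ : ∀ l → ∃[ l′ ] omit₂ j l′ ≡ omit₂ i l
  tail-⊆ l with suc l′ , eq ← ⊆ (suc l) = l′ , suc-injective eq

Uniform : Family k h (Fin (suc d)) m → ℕ → Set
Uniform F x = ∀ i → cost zero (member F i) ≡ x

-- In all constructions colour `zero` is the unpainted one.
Economical : (k d h x : ℕ) → Set
Economical k d h x = Σ[ c ∈ (Position k h → Fin (suc d)) ] Rigid c × cost zero c ≡ x

omit-iterate : ∀ m {x} (F : Family k h (Fin (suc d)) (suc k)) → Uniform F x →
  Σ[ G ∈ Family k (m + h) (Fin (suc d)) (suc k) ] Uniform G (k ^ m * x)
omit-iterate zero    F uniform = F , λ i → trans (uniform i) (sym (+-identityʳ _))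
omit-iterate {k} (suc m) {x} F uniform with G , uniform′ ← omit-iterate m F uniform =
  omit G , λ j → trans (sum-cong-≗ {k} (λ l → uniform′ (punchIn j l)))
    (trans (sum-const k (k ^ m * x)) (sym (*-assoc k (k ^ m) x)))

grow : ∀ m {x} (F : Family k h (Fin (suc d)) (suc k)) → Uniform F x →
  Economical k d (m + h) (k ^ m * x)
grow m F uniform with G , uniform′ ← omit-iterate m F uniform =
  member G zero , rigid G zero , uniform′ zero

module _ {k₂ : ℕ} where

  private
    k₁ = suc k₂
    k′ = suc k₁

  mixed : Family k′ h (Fin (suc d)) (2 + k′) → Family k′ (suc h) (Fin (suc d)) (suc k′)
  mixed F = record
    { member   = λ j → paint zero (member F ∘ keep-first j)
    ; rigid    = λ j → paint-rigid F zero (keep-first j) (keep-first-injective j)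
    ; distinct = λ s → keep-first-⊆⇒≡ (paint-Similar⇒⊆ F s)
    }

  mixed-Uniform : ∀ {x y} (F : Family k′ h (Fin (suc d)) (2 + k′)) → cost zero (member F zero) ≡ x →
    (∀ i → cost zero (member F (suc i)) ≡ y) → Uniform (mixed F) (x + k₁ * y)
  mixed-Uniform {y = y} F eq₀ eq j =
    cong₂ _+_ eq₀ (trans (sum-cong-≗ {k₁} (eq ∘ omit₂ j)) (sum-const k₁ y))

  -- The leaves alone form a family for `mixed`: one of cost 0 and k + 1 painted ones of cost 1.
  k+2-colours-economical : ∀ m → 2 + k′ ≤ suc d → Economical k′ d (m + 1) (k′ ^ m * k₁)
  k+2-colours-economical {d} m k+2≤d = grow m (mixed L)
    (λ j → trans (mixed-Uniform L refl (λ _ → refl) j) (*-identityʳ k₁))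
    where
    L : Family k′ 0 (Fin (suc d)) (2 + k′)
    L = leafFamily (λ i → inject≤ i k+2≤d) (inject≤-injective k+2≤d k+2≤d _ _)

  module _ {d : ℕ} (k+1≤d : suc k′ ≤ suc d) where

    private
      ι : Fin (suc k′) → Fin (suc d)
      ι i = inject≤ i k+1≤d

      stars : Family k′ 1 (Fin (suc d)) (suc k′)
      stars = omit (leafFamily ι (inject≤-injective k+1≤d k+1≤d _ _))

      -- Star `zero` omits the unpainted colour, so all its leaves are painted; every other star
      -- keeps one unpainted leaf.
      star-cost₀ : cost zero (member stars zero) ≡ k′
      star-cost₀ = trans (sum-const k′ 1) (*-identityʳ k′)

      star-cost₊ : ∀ j → cost zero (member stars (suc j)) ≡ k₁
      star-cost₊ j = trans (sum-const k₁ 1) (*-identityʳ k₁)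

      depth-2-cost : sum (λ l → cost zero (member stars (suc l))) ≡ k′ * k₁
      depth-2-cost = trans (sum-cong-≗ star-cost₊) (sum-const k′ k₁)

      -- The cheapest colouring, followed by colourings that cost one more.
      depth-2-member : Fin (2 + k′) → Position k′ 2 → Fin (suc d)
      depth-2-member zero          = member (omit stars) zero
      depth-2-member (suc zero)    = member (omit stars) (suc zero)
      depth-2-member (suc (suc c)) = paint (ι (suc c)) (member stars ∘ suc)

      depth-2-rigid : ∀ i → Rigid (depth-2-member i)
      depth-2-rigid zero          = rigid (omit stars) zero
      depth-2-rigid (suc zero)    = rigid (omit stars) (suc zero)
      depth-2-rigid (suc (suc c)) = paint-rigid stars (ι (suc c)) suc suc-injective

      depth-2-distinct : Distinct depth-2-member
      depth-2-distinct {zero}        {zero}        s = refl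
      depth-2-distinct {zero}        {suc zero}    s = contradiction (distinct (omit stars) {zero} {suc zero} s) λ ()
      depth-2-distinct {zero}        {suc (suc _)} s = contradiction (Similar-root s) λ ()
      depth-2-distinct {suc zero}    {zero}        s = contradiction (distinct (omit stars) {suc zero} {zero} s) λ ()
      depth-2-distinct {suc zero}    {suc zero}    s = refl
      depth-2-distinct {suc zero}    {suc (suc _)} s = contradiction (Similar-root s) λ ()
      depth-2-distinct {suc (suc _)} {zero}        s = contradiction (Similar-root s) λ ()
      depth-2-distinct {suc (suc _)} {suc zero}    s = contradiction (Similar-root s) λ ()
      depth-2-distinct {suc (suc _)} {suc (suc _)} s =
        cong suc (inject≤-injective k+1≤d k+1≤d _ _ (Similar-root s))

      depth-2 : Family k′ 2 (Fin (suc d)) (2 + k′)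
      depth-2 = record
        { member = depth-2-member ; rigid = depth-2-rigid ; distinct = depth-2-distinct }

      -- One extra vertex is painted in either of two ways: the costlier star `zero` replaces
      -- another star, or the root of the cheapest colouring takes one of k painted colours.
      depth-2-cost₊ : ∀ i → cost zero (depth-2-member (suc i)) ≡ suc (k′ * k₁)
      depth-2-cost₊ zero    =
        cong₂ _+_ star-cost₀ (trans (sum-cong-≗ {k₁} (λ l → star-cost₊ (suc l))) (sum-const k₁ k₁))
      depth-2-cost₊ (suc c) = cong suc depth-2-cost

    depth-2-economical : Economical k′ d 2 (k′ * k₁)
    depth-2-economical = depth-2-member zero , depth-2-rigid zero , depth-2-cost

    k+1-colours-economical : ∀ m → Economical k′ d (m + 3) (k′ ^ m * (k′ * k₁ + k₁ * suc (k′ * k₁)))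
    k+1-colours-economical m =
      grow m (mixed depth-2) (mixed-Uniform depth-2 depth-2-cost depth-2-cost₊)

rainbow : ∀ h → Fin k → Position k h → Fin k
rainbow h       c root      = c
rainbow (suc h) c (sub j p) = rainbow h j p

rainbow-root : ∀ h {c : Fin k} → rainbow h c root ≡ c
rainbow-root zero    = refl
rainbow-root (suc h) = refl

rainbow-distinct : ∀ h → Distinct (rainbow {k} h)
rainbow-distinct h {i} {j} s =
  trans (sym (rainbow-root h)) (trans (Similar-root s) (rainbow-root h))

rainbow-rigid : ∀ h (c : Fin k) → Rigid (rainbow h c)
rainbow-rigid zero    c = rigid-leaf _
rainbow-rigid (suc h) c = rigid-node _ (rainbow-rigid h) (rainbow-distinct h)

-- The equality case of `k-colours-cost≥`: only the branch with root colour `zero` saves one.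
rainbow-cost : ∀ {k₁} h (c : Fin (suc k₁)) →
  suc (cost zero (rainbow h c)) ≡ suc k₁ ^ h + mismatch zero c
rainbow-cost      zero    c = refl
rainbow-cost {k₁} (suc h) c = begin
  suc (r + (f zero + sum (f ∘ suc)))      ≡⟨ cong suc (+-comm r _) ⟩
  suc (f zero) + sum (f ∘ suc) + r        ≡⟨ cong (_+ r) (cong₂ _+_ f₀ (trans (sum-cong-≗ f₊) (sum-const k₁ x))) ⟩
  x + k₁ * x + r                          ∎
  where
  open ≡-Reasoning
  x = suc k₁ ^ h
  r = mismatch zero c
  f : Fin (suc k₁) → ℕ
  f j = cost zero (rainbow h j)
  f₀ : suc (f zero) ≡ x
  f₀ = trans (rainbow-cost h zero) (+-identityʳ x)
  f₊ : ∀ j → f (suc j) ≡ x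
  f₊ j = ℕ.suc-injective (trans (rainbow-cost h (suc j)) (+-comm x 1))

-- Rooted trees inside graphs

index : (S : Subset n) → Fin ∣ S ∣ → Fin n
index (inside  ∷ S) zero    = zero
index (inside  ∷ S) (suc i) = suc (index S i)
index (outside ∷ S) i       = suc (index S i)

index-injective : (S : Subset n) → Injective _≡_ _≡_ (index S)
index-injective (inside  ∷ S) {zero}  {zero}  eq = refl
index-injective (inside  ∷ S) {suc _} {suc _} eq = cong suc (index-injective S (suc-injective eq))
index-injective (outside ∷ S)                 eq = index-injective S (suc-injective eq)

index-∈ : (S : Subset n) → ∀ i → index S i ∈ S
index-∈ (inside  ∷ S) zero    = here
index-∈ (inside  ∷ S) (suc i) = there (index-∈ S i)
index-∈ (outside ∷ S) i       = there (index-∈ S i)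

∈⇒index : {S : Subset n} {v : Fin n} → v ∈ S → ∃[ i ] index S i ≡ v
∈⇒index here = zero , refl
∈⇒index {S = inside  ∷ S} (there v∈S) with i , eq ← ∈⇒index v∈S = suc i , cong suc eq
∈⇒index {S = outside ∷ S} (there v∈S) with i , eq ← ∈⇒index v∈S = i , cong suc eq

module _ {P : Fin n → Set} (P? : Decidable P) where

  ∈-comprehension⁺ : ∀ {v} → P v → v ∈ comprehension P?
  ∈-comprehension⁺ {v} pv = lookup⇒[]= v _ (trans (lookup∘tabulate _ v) (dec-true (P? v) pv))

  ∈-comprehension⁻ : ∀ {v} → v ∈ comprehension P? → P v
  ∈-comprehension⁻ {v} v∈ with P? v | trans (sym (lookup∘tabulate (λ w → does (P? w)) v)) ([]=⇒lookup v∈)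
  ... | yes pv | _ = pv

-- This counts elements and not proofs: `Up v w` may hold through many walks, but w is listed once.
record Enumeration {A : Set} (P : A → Set) (m : ℕ) : Set where
  field
    element   : Fin m → A
    injective : Injective _≡_ _≡_ element
    sound     : ∀ i → P (element i)
    complete  : ∀ {w} → P w → ∃[ i ] element i ≡ w

open Enumeration

enumerate : {P : Fin n → Set} (P? : Decidable P) → Enumeration P ∣ comprehension P? ∣
enumerate P? = record
  { element   = index S
  ; injective = index-injective S
  ; sound     = λ i → ∈-comprehension⁻ P? (index-∈ S i)
  ; complete  = λ pw → ∈⇒index (∈-comprehension⁺ P? pw)
  }
  where S = comprehension P?

module _ {A : Set} {P Q : A → Set} where

  convert : (∀ {w} → P w → Q w) → (∀ {w} → Q w → P w) → Enumeration P m → Enumeration Q m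
  convert to from e = record
    { element   = element e
    ; injective = injective e
    ; sound     = to ∘ sound e
    ; complete  = complete e ∘ from
    }

  enumeration-≤ : (f : A → A) → Injective _≡_ _≡_ f → (∀ {w} → P w → Q (f w)) →
    Enumeration P m → Enumeration Q n → m ≤ n
  enumeration-≤ {m} {n} f f-inj P⇒Q d e = injective⇒≤ {f = proj₁ ∘ hit} λ {i} {j} eq →
    injective d (f-inj (trans (sym (proj₂ (hit i))) (trans (cong (element e) eq) (proj₂ (hit j)))))
    where
    hit : ∀ i → ∃[ j ] element e j ≡ f (element d i)
    hit i = complete e (P⇒Q (sound d i))

remove : {A : Set} {P : A → Set} {p : A} → P p → Enumeration P (suc m) →
  Enumeration (λ w → P w × w ≢ p) m
remove {P = P} {p} Pp e = record
  { element   = element e ∘ punchIn i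
  ; injective = punchIn-injective i _ _ ∘ injective e
  ; sound     = λ j → sound e (punchIn i j) ,
                  λ eq → punchInᵢ≢i i j (injective e (trans eq (sym eᵢ≡p)))
  ; complete  = λ (Pw , w≢p) → hit Pw w≢p
  }
  where
  i = proj₁ (complete e Pp)
  eᵢ≡p = proj₂ (complete e Pp)
  hit : ∀ {w} → P w → w ≢ p → ∃[ j ] element e (punchIn i j) ≡ w
  hit Pw w≢p = punchOut i≢ , trans (cong (element e) (punchIn-punchOut i≢)) (proj₂ (complete e Pw))
    where
    i≢ : i ≢ proj₁ (complete e Pw)
    i≢ eq = w≢p (trans (sym (proj₂ (complete e Pw))) (trans (cong (element e) (sym eq)) eᵢ≡p))

module Rooted (G : Graph) (connected : Connected G) (acyclic : Acyclic G) (r : Graph.Vertex G) where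

  open Graph G

  private variable
    a b c p q u v v′ w x : Vertex

  -- Walks in the graph with x deleted, repetitions allowed.
  data Avoiding (x : Vertex) : Vertex → Vertex → Set where
    stop : a ≢ x → Avoiding x a a
    step : a ≢ x → a ~ b → Avoiding x b c → Avoiding x a c

  start≢ : Avoiding x a b → a ≢ x
  start≢ (stop a≢x)     = a≢x
  start≢ (step a≢x _ _) = a≢x

  end≢ : Avoiding x a b → b ≢ x
  end≢ (stop a≢x)   = a≢x
  end≢ (step _ _ t) = end≢ t

  infixr 5 _◅◅_
  _◅◅_ : Avoiding x a b → Avoiding x b c → Avoiding x a c
  stop _         ◅◅ t = t
  step a≢x a~b s ◅◅ t = step a≢x a~b (s ◅◅ t)

  reversed : Avoiding x a b → Avoiding x b a
  reversed (stop a≢x)       = stop a≢x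
  reversed (step a≢x a~b t) = reversed t ◅◅ step (start≢ t) (~-sym a~b) (stop a≢x)

  record Path (x a b : Vertex) : Set where
    field
      {length} : ℕ
      walk     : Walk G length a b
      unique   : Unique (vertices G walk)
      avoids   : All (_≢ x) (vertices G walk)

  suffix : (t : Walk G m b c) → Unique (vertices G t) → All (_≢ x) (vertices G t) →
    a ∈ₗ vertices G t → Path x a c
  suffix []      uniq       avoid       (here refl) = record { walk = [] ; unique = uniq ; avoids = avoid }
  suffix (e ∷ t) uniq       avoid       (here refl) = record { walk = e ∷ t ; unique = uniq ; avoids = avoid }
  suffix (e ∷ t) (_ ∷ uniq) (_ ∷ avoid) (there a∈)  = suffix t uniq avoid a∈

  -- Loop erasure: if the new start already lies on the path found so far, only the suffix from
  -- there is kept.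
  path : Avoiding x a b → Path x a b
  path (stop a≢x) = record { walk = [] ; unique = [] ∷ [] ; avoids = a≢x ∷ [] }
  path {a = a} (step a≢x a~b t)
    with record { walk = walk ; unique = unique ; avoids = avoids } ← path t
    with _∈?_ _≟_ a (vertices G walk)
  ... | yes a∈ = suffix walk unique avoids a∈
  ... | no  a∉ = record { walk = a~b ∷ walk ; unique = ¬Any⇒All¬ _ a∉ ∷ unique ; avoids = a≢x ∷ avoids }

  -- Otherwise v closes a path between its two neighbours to a cycle.
  joined-neighbours-≡ : Avoiding v a b → v ~ a → v ~ b → a ≡ b
  joined-neighbours-≡ t v~a v~b with path t
  ... | record { walk = [] } = refl
  ... | record { walk = e ∷ s ; unique = unique ; avoids = avoids } = contradiction (~-sym v~b)
    (acyclic (v~a ∷ e ∷ s) (All.map (λ w≢v → w≢v ∘ sym) avoids ∷ unique) (s≤s (s≤s z≤n)))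

  -- p is the parent of v in the tree rooted at r.
  Up : Vertex → Vertex → Set
  Up p v = p ~ v × Avoiding v p r

  ¬Up-root : ¬ Up p r
  ¬Up-root (_ , t) = end≢ t refl

  Up-unique : Up p v → Up q v → p ≡ q
  Up-unique (p~v , s) (q~v , t) = joined-neighbours-≡ (s ◅◅ reversed t) (~-sym p~v) (~-sym q~v)

  -- The parent is the vertex that follows the last visit to v on a walk from v to the root.
  parent : v ≢ r → ∃[ p ] Up p v
  parent {v} v≢r with last-visit (proj₂ (connected v r))
    where
    last-visit : Walk G m u r → (∃[ p ] Up p v) ⊎ Avoiding v u r
    last-visit [] = inj₂ (stop (v≢r ∘ sym))
    last-visit {u = u} (_∷_ {v = w} u~w t) with last-visit t
    ... | inj₁ found = inj₁ found
    ... | inj₂ s with u ≟ v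
    ...   | yes refl = inj₁ (w , ~-sym u~w , s)
    ...   | no  u≢v  = inj₂ (step u≢v u~w s)
  ... | inj₁ found = found
  ... | inj₂ t     = contradiction refl (start≢ t)

  avoids-or-meets : ∀ w → Avoiding u a b → Avoiding w a b ⊎ Avoiding u a w
  avoids-or-meets {a = a} w t with a ≟ w
  avoids-or-meets w t                | yes refl = inj₂ (stop (start≢ t))
  avoids-or-meets w (stop _)         | no a≢w = inj₁ (stop a≢w)
  avoids-or-meets w (step a≢u a~b t) | no a≢w with avoids-or-meets w t
  ... | inj₁ s = inj₁ (step a≢w a~b s)
  ... | inj₂ s = inj₂ (step a≢u a~b s)

  -- A walk leads from u through its parent p to the root. If it avoids w, then u is the parent of
  -- w. If it meets w, then p and w are neighbours of u joined outside u, hence equal.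
  Up-or-Up : u ~ w → Up u w ⊎ Up w u
  Up-or-Up {u} {w} u~w with u ≟ r
  ... | yes refl = inj₁ (u~w , stop λ u≡w → ~-irrefl u≡w u~w)
  ... | no u≢r with p , p~u , t ← parent u≢r with avoids-or-meets w t
  ...   | inj₁ s = inj₁ (u~w , step (λ u≡w → ~-irrefl u≡w u~w) (~-sym p~u) s)
  ...   | inj₂ s with refl ← joined-neighbours-≡ s (~-sym p~u) u~w = inj₂ (p~u , t)

  data Depth : ℕ → Vertex → Set where
    top  : Depth 0 r
    down : Depth m p → Up p v → Depth (suc m) v

  Depth-unique : Depth m v → Depth n v → m ≡ n
  Depth-unique top        top        = refl
  Depth-unique top        (down _ e) = contradiction e ¬Up-root
  Depth-unique (down _ e) top        = contradiction e ¬Up-root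
  Depth-unique (down s d) (down t e) with refl ← Up-unique d e = cong suc (Depth-unique s t)

  Depth-step : Depth m u → u ~ w → Depth (suc m) w ⊎ (∃[ l ] m ≡ suc l × Depth l w)
  Depth-step t u~w with Up-or-Up u~w
  ... | inj₁ d = inj₁ (down t d)
  Depth-step top        u~w | inj₂ e = contradiction e ¬Up-root
  Depth-step (down s d) u~w | inj₂ e with refl ← Up-unique d e = inj₂ (_ , refl , s)

  depth : ∀ v → ∃[ m ] Depth m v
  depth v = along (proj₂ (connected r v)) (0 , top)
    where
    along : Walk G n u w → ∃[ m ] Depth m u → ∃[ m ] Depth m w
    along []      d       = d
    along (e ∷ t) (_ , d) with Depth-step d e
    ... | inj₁ d′           = along t (_ , d′)
    ... | inj₂ (_ , _ , d′) = along t (_ , d′)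

  walk⇒Depth≤ : ∀ {l} → Walk G l u v → Depth m u → Depth n v → n ≤ m + l
  walk⇒Depth≤ []                  d d′ = ≤-reflexive (trans (Depth-unique d′ d) (sym (+-identityʳ _)))
  walk⇒Depth≤ {m = m} {l = suc l} (e ∷ t) d d′ with Depth-step d e
  ... | inj₁ d″              = ≤-trans (walk⇒Depth≤ t d″ d′) (≤-reflexive (sym (+-suc m l)))
  ... | inj₂ (o , refl , d″) = ≤-trans (walk⇒Depth≤ t d″ d′) (+-mono-≤ (n≤1+n o) (n≤1+n l))

  Depth⇒walk : Depth m v → Walk G m r v
  Depth⇒walk top              = []
  Depth⇒walk (down d (e , _)) = snoc (Depth⇒walk d) e
    where
    snoc : Walk G m u v → v ~ w → Walk G (suc m) u w
    snoc []      e = e ∷ []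
    snoc (d ∷ t) e = d ∷ snoc t e

  ancestor : Depth m v → n ≤ m → ∃[ w ] Depth n w
  ancestor {m} {v} d n≤m with m≤n⇒m<n∨m≡n n≤m
  ... | inj₂ refl = v , d
  ancestor (down d _) n≤m | inj₁ n<m = ancestor d (s≤s⁻¹ n<m)

  -- The ancestors of v at the depths 0 to m are m + 1 different vertices.
  Depth<order : Depth m v → m < order
  Depth<order {m} d = injective⇒≤ {f = λ i → proj₁ (above i)} λ {i} {j} eq →
    toℕ-injective (Depth-unique (proj₂ (above i)) (subst (Depth (toℕ j)) (sym eq) (proj₂ (above j))))
    where
    above : (i : Fin (suc m)) → ∃[ w ] Depth (toℕ i) w
    above i = ancestor d (s≤s⁻¹ (toℕ<n i))

  data Below : ℕ → Vertex → Vertex → Set where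
    here  : Below 0 a a
    below : ∀ {l} → Below l a p → Up p w → Below (suc l) a w

  -- Climbing l steps from w reaches one vertex only. This makes the branches at different children
  -- disjoint.
  Below-unique : ∀ {l} → Below l a w → Below l b w → a ≡ b
  Below-unique here        here        = refl
  Below-unique (below s d) (below t e) with refl ← Up-unique d e = Below-unique s t

  Up-Below : ∀ {l} → Up v a → Below l a w → Below (suc l) v w
  Up-Below d here        = below here d
  Up-Below d (below s e) = below (Up-Below d s) e

  Below-Depth : ∀ {l} → Depth m a → Below l a w → Depth (l + m) w
  Below-Depth d here        = d
  Below-Depth d (below s e) = down (Below-Depth d s) e

  -- The subtree hanging from v is perfect of depth h.
  data Branch (k : ℕ) : ℕ → Vertex → Set where
    leaf : (∀ w → ¬ Up v w) → Branch k 0 v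
    node : (children : Enumeration (Up v) k) → (∀ j → Branch k h (element children j)) →
      Branch k (suc h) v

  embed : Branch k h v → Position k h → Vertex
  embed {v = v} _ root              = v
  embed (node _ bs)       (sub j p) = embed (bs j) p

  level : Position k h → ℕ
  level root      = 0
  level (sub _ p) = suc (level p)

  embed-Below : (b : Branch k h v) (p : Position k h) → Below (level p) v (embed b p)
  embed-Below b            root      = here
  embed-Below (node ch bs) (sub j p) = Up-Below (sound ch j) (embed-Below (bs j) p)

  embed-Depth : Depth m v → (b : Branch k h v) (p : Position k h) → Depth (level p + m) (embed b p)
  embed-Depth d b p = Below-Depth d (embed-Below b p)

  -- Equal vertices have equal depth, so the positions have equal level; then both pass through the
  -- same child at every step.
  embed-injective : Depth m v → (b : Branch k h v) {p q : Position k h} →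
    embed b p ≡ embed b q → p ≡ q
  embed-injective {m} d b {p} {q} eq = go d b p q eq (+-cancelʳ-≡ m _ _ (Depth-unique
    (embed-Depth d b p) (subst (Depth (level q + m)) (sym eq) (embed-Depth d b q))))
    where
    go : Depth n v → (b : Branch k h v) (p q : Position k h) → embed b p ≡ embed b q →
      level p ≡ level q → p ≡ q
    go d b            root      root      eq ℓ = refl
    go d (node ch bs) (sub i p) (sub j q) eq ℓ with refl ← injective ch {i} {j} (Below-unique
      (embed-Below (bs i) p)
      (subst₂ (λ l → Below l _) (sym (ℕ.suc-injective ℓ)) (sym eq) (embed-Below (bs j) q))) =
      cong (sub i) (go (down d (sound ch i)) (bs i) p q eq (ℕ.suc-injective ℓ))

  Parent⇒Up : (b : Branch k h v) {p q : Position k h} → Parent p q → Up (embed b p) (embed b q)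
  Parent⇒Up (node ch bs) (root i)  = sound ch i
  Parent⇒Up (node ch bs) (sub i e) = Parent⇒Up (bs i) e

  Up⇒Parent : Depth m v → (b : Branch k h v) {p q : Position k h} →
    Up (embed b p) (embed b q) → Parent p q
  Up⇒Parent {m} d b {p} {q} e = go d b p q e (sym (+-cancelʳ-≡ m _ _ (Depth-unique
    (down (embed-Depth d b p) e) (embed-Depth d b q))))
    where
    go : Depth n v → (b : Branch k h v) (p q : Position k h) → Up (embed b p) (embed b q) →
      level q ≡ suc (level p) → Parent p q
    go d b            root      (sub j root) e ℓ = root j
    go d (node ch bs) (sub i p) (sub j q)    e ℓ with refl ← injective ch {i} {j} (Below-unique
      (below (embed-Below (bs i) p) e)
      (subst (λ l → Below l (element ch j) (embed (bs j) q)) (ℕ.suc-injective ℓ) (embed-Below (bs j) q))) =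
      sub i (go (down d (sound ch i)) (bs i) p q e (ℕ.suc-injective ℓ))

  embed-child : (b : Branch k h v) (p : Position k h) → Up (embed b p) w → ∃[ q ] embed b q ≡ w
  embed-child {w = w} (leaf childless) root e = contradiction e (childless w)
  embed-child (node ch bs) root      e with j , eq ← complete ch e = sub j root , eq
  embed-child (node ch bs) (sub j p) e with q , eq ← embed-child (bs j) p e = sub j q , eq

  embed-onto : (b : Branch k h r) → Depth m v → ∃[ p ] embed b p ≡ v
  embed-onto b top        = root , refl
  embed-onto b (down d e) with p , refl ← embed-onto b d = embed-child b p e

  -- Automorphisms

  opposite : Automorphism G → Automorphism G
  opposite φ = record
    { permutation = flip π
    ; preserves-~ = λ u v → mk⇔
        (λ u~v → Equivalence.from (preserves-~ _ _)
          (subst₂ _~_ (sym (inverseʳ π)) (sym (inverseʳ π)) u~v))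
        (λ πu~πv → subst₂ _~_ (inverseʳ π) (inverseʳ π) (Equivalence.to (preserves-~ _ _) πu~πv))
    }
    where open Automorphism φ renaming (permutation to π)

  module _ (φ : Automorphism G) where

    open Automorphism φ renaming (permutation to π)

    ·-injective : Injective _≡_ _≡_ (π ⟨$⟩ʳ_)
    ·-injective eq = trans (sym (inverseˡ π)) (trans (cong (π ⟨$⟩ˡ_) eq) (inverseˡ π))

    ·-~ : u ~ v → (π ⟨$⟩ʳ u) ~ (π ⟨$⟩ʳ v)
    ·-~ = Equivalence.to (preserves-~ _ _)

    degree-≤ : ∀ v → degree G v ≤ degree G (π ⟨$⟩ʳ v)
    degree-≤ v = enumeration-≤ (π ⟨$⟩ʳ_) ·-injective ·-~ (enumerate (v ~?_)) (enumerate ((π ⟨$⟩ʳ v) ~?_))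

    module _ (fixes-r : π ⟨$⟩ʳ r ≡ r) where

      ·-Avoiding : Avoiding x a b → Avoiding (π ⟨$⟩ʳ x) (π ⟨$⟩ʳ a) (π ⟨$⟩ʳ b)
      ·-Avoiding (stop a≢x)     = stop (a≢x ∘ ·-injective)
      ·-Avoiding (step a≢x e t) = step (a≢x ∘ ·-injective) (·-~ e) (·-Avoiding t)

      ·-Up : Up p v → Up (π ⟨$⟩ʳ p) (π ⟨$⟩ʳ v)
      ·-Up (e , t) = ·-~ e , subst (Avoiding _ _) fixes-r (·-Avoiding t)

      -- Children of v go to children of the image of v, which gives the permutation at this node.
      -- Two branches are compared because the recursion passes from a subtree to its image.
      restrict : (b : Branch k h v) (b′ : Branch k h v′) → π ⟨$⟩ʳ v ≡ v′ →
        Σ[ a ∈ TreeAut k h ] (∀ p → embed b′ (act a p) ≡ π ⟨$⟩ʳ embed b p)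
      restrict (leaf _)     (leaf _)       eq = leaf , λ { root → sym eq }
      restrict {k} {suc h} (node ch bs) (node ch′ bs′) refl =
        node (proj₁ σ) (proj₁ ∘ subtree) , λ where
          root      → refl
          (sub i p) → proj₂ (subtree i) p
        where
        hit : ∀ i → ∃[ j ] element ch′ j ≡ π ⟨$⟩ʳ element ch i
        hit i = complete ch′ (·-Up (sound ch i))
        σ = injective⇒permutation (proj₁ ∘ hit) λ {i} {j} eq → injective ch (·-injective
          (trans (sym (proj₂ (hit i))) (trans (cong (element ch′) eq) (proj₂ (hit j)))))
        subtree : ∀ i → Σ[ a ∈ TreeAut k h ]
          (∀ p → embed (bs′ (proj₁ σ ⟨$⟩ʳ i)) (act a p) ≡ π ⟨$⟩ʳ embed (bs i) p)
        subtree i = restrict (bs i) (bs′ (proj₁ σ ⟨$⟩ʳ i))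
          (trans (sym (proj₂ (hit i))) (cong (element ch′) (sym (proj₂ σ i))))

-- Counting vertices through positions

size : ℕ → ℕ → ℕ
size k zero    = 1
size k (suc h) = suc (k * size k h)

encode : Position k h → Fin (size k h)
encode {h = zero}  root      = zero
encode {h = suc h} root      = zero
encode {h = suc h} (sub i p) = suc (combine i (encode p))

decode : ∀ k h → Fin (size k h) → Position k h
decode k zero    _       = root
decode k (suc h) zero    = root
decode k (suc h) (suc x) =
  sub (proj₁ (remQuot {k} (size k h) x)) (decode k h (proj₂ (remQuot {k} (size k h) x)))

decode-combine : ∀ i (x : Fin (size k h)) → decode k (suc h) (suc (combine i x)) ≡ sub i (decode k h x)
decode-combine {k} {h} i x = cong (λ (j , y) → sub j (decode k h y)) (remQuot-combine {k} i x)

decode-encode : (p : Position k h) → decode k h (encode p) ≡ p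
decode-encode {h = zero}  root      = refl
decode-encode {h = suc h} root      = refl
decode-encode {h = suc h} (sub i p) =
  trans (decode-combine i (encode p)) (cong (sub i) (decode-encode p))

encode-decode : ∀ k h (x : Fin (size k h)) → encode (decode k h x) ≡ x
encode-decode k zero    zero    = refl
encode-decode k (suc h) zero    = refl
encode-decode k (suc h) (suc x) = cong suc (trans
  (cong (combine (proj₁ (remQuot {k} (size k h) x))) (encode-decode k h _))
  (combine-remQuot {k} (size k h) x))

-- As a sum over a `Fin`, the cost can be carried over to the vertices of the graph by
-- `sum-permute`.
total-decode : ∀ h (g : Position k h → ℕ) → total g ≡ sum (g ∘ decode k h)
total-decode     zero    g = sym (+-identityʳ (g root))
total-decode {k} (suc h) g = cong (g root +_) (begin
  sum (λ i → total (g ∘ sub i))                                         ≡⟨ sum-cong-≗ (λ i → total-decode h (g ∘ sub i)) ⟩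
  sum (λ i → sum (λ x → g (sub i (decode k h x))))                      ≡⟨ sum-cong-≗ (λ i → sum-cong-≗ (λ x → cong g (decode-combine i x))) ⟨
  sum (λ i → sum (λ x → g (decode k (suc h) (suc (combine {k} i x))))) ≡⟨ sum-combine k (g ∘ decode k (suc h) ∘ suc) ⟨
  sum (g ∘ decode k (suc h) ∘ suc)                                      ∎)
  where open ≡-Reasoning

total-cong : ∀ h {f g : Position k h → ℕ} → (∀ p → f p ≡ g p) → total f ≡ total g
total-cong zero    eq = eq root
total-cong (suc h) eq = cong₂ _+_ (eq root) (sum-cong-≗ (λ i → total-cong h (eq ∘ sub i)))

Rigid-cong : {c c′ : Position k h → C} → (∀ p → c p ≡ c′ p) → Rigid c → Rigid c′
Rigid-cong eq rigid a pres = rigid a (λ p → trans (eq _) (trans (pres p) (sym (eq p))))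

∣∁-tabulate∣ : (f : Fin n → Bool) → ∣ ∁ (tabulate f) ∣ ≡ sum (λ v → if f v then 0 else 1)
∣∁-tabulate∣ {zero}  f = refl
∣∁-tabulate∣ {suc n} f with f zero
... | true  = ∣∁-tabulate∣ (f ∘ suc)
... | false = cong suc (∣∁-tabulate∣ (f ∘ suc))

Least-unique : {P : ℕ → Set} → Least P m → Least P n → m ≡ n
Least-unique (pm , m≤) (pn , n≤) = ≤-antisym (m≤ _ pn) (n≤ _ pm)

-- Perfect trees: identification with positions, colourings, paint costs and fixing sets

module PerfectTree (G : Graph) {k₁ n : ℕ} (tree : IsPerfectTree G (suc k₁) n) (1≤k₁ : 1 ≤ k₁) where

  open Graph G
  open IsPerfectTree tree renaming (root to r)
  open Rooted G connected acyclic r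

  private
    k′ = suc k₁

    variable
      v w : Vertex

  Up-asym : Up v w → ¬ Up w v
  Up-asym {v} e e′ with m , d ← depth v =
    contradiction (Depth-unique d (down (down d e) e′)) λ eq →
      contradiction (≤-reflexive (sym eq)) (<⇒≱ (m≤n⇒m≤1+n ≤-refl))

  -- Every neighbour is a child or the parent. The root has k neighbours and no parent; any other
  -- internal vertex has k + 1, one of them its parent.
  children : ¬ Leaf G v → Enumeration (Up v) k′
  children {v} ¬leaf with v ≟ r
  ... | yes refl = convert r~⇒Up proj₁ (subst (Enumeration (r ~_)) root-degree (enumerate (r ~?_)))
    where
    r~⇒Up : r ~ w → Up r w
    r~⇒Up r~w with Up-or-Up r~w
    ... | inj₁ e = e
    ... | inj₂ e = contradiction e ¬Up-root
  ... | no v≢r with p , e ← parent v≢r = convert (λ (v~w , w≢p) → to v~w w≢p) from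
    (remove (~-sym (proj₁ e)) (subst (Enumeration (v ~_)) (internal-degree v v≢r ¬leaf) (enumerate (v ~?_))))
    where
    to : v ~ w → w ≢ p → Up v w
    to v~w w≢p with Up-or-Up v~w
    ... | inj₁ e′ = e′
    ... | inj₂ e′ = contradiction (Up-unique e′ e) w≢p
    from : Up v w → v ~ w × w ≢ p
    from e′ = proj₁ e′ , λ { refl → Up-asym e′ e }

  -- A walk gains at most one level per edge, and the ancestors form a walk as long as the depth, so
  -- depth agrees with distance.
  leaf⇒Depth≡n : Depth m v → Leaf G v → m ≡ n
  leaf⇒Depth≡n {v = v} d isLeaf with walk , n≤ ← leaf-depth v isLeaf =
    ≤-antisym (walk⇒Depth≤ walk top d) (n≤ _ (Depth⇒walk d))

  -- The recursion stops since there are no vertices of depth at least order.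
  internal⇒Depth<n : ∀ l → order ≤ m + l → Depth m v → ¬ Leaf G v → m < n
  internal⇒Depth<n {m} zero    order≤ d ¬leaf = contradiction
    (≤-trans order≤ (≤-reflexive (+-identityʳ m))) (<⇒≱ (Depth<order d))
  internal⇒Depth<n {m} (suc l) order≤ d ¬leaf with leaf? G (element (children ¬leaf) zero)
  ... | yes isLeaf = ≤-reflexive (leaf⇒Depth≡n (down d (sound (children ¬leaf) zero)) isLeaf)
  ... | no ¬leaf′ = <-trans (n<1+n m)
    (internal⇒Depth<n l (≤-trans order≤ (≤-reflexive (+-suc m l)))
      (down d (sound (children ¬leaf) zero)) ¬leaf′)

  Depth≤n : Depth m v → m ≤ n
  Depth≤n {m} {v} d with leaf? G v
  ... | yes isLeaf = ≤-reflexive (leaf⇒Depth≡n d isLeaf)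
  ... | no ¬leaf = <⇒≤ (internal⇒Depth<n order (m≤n+m order m) d ¬leaf)

  Depth<n⇒internal : Depth m v → m < n → ¬ Leaf G v
  Depth<n⇒internal d m<n isLeaf = <-irrefl (leaf⇒Depth≡n d isLeaf) m<n

  -- Above depth n every vertex is internal and has k children; at depth n a child would lie too
  -- deep.
  branch : ∀ h → Depth m v → m + h ≡ n → Branch k′ h v
  branch {m} zero    d eq = leaf λ w e →
    <⇒≱ (n<1+n m) (≤-trans (Depth≤n (down d e)) (≤-reflexive (trans (sym eq) (+-identityʳ m))))
  branch {m} (suc h) d eq = node ch λ j → branch h (down d (sound ch j)) eq′
    where
    eq′ = trans (sym (+-suc m h)) eq
    ch = children (Depth<n⇒internal d (≤-trans (m≤m+n (suc m) h) (≤-reflexive eq′)))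

  perfect : Branch k′ n r
  perfect = branch n top refl

  vertex : Position k′ n → Vertex
  vertex = embed perfect

  address : Vertex → Position k′ n
  address v = proj₁ (embed-onto perfect (proj₂ (depth v)))

  vertex-address : ∀ v → vertex (address v) ≡ v
  vertex-address v = proj₂ (embed-onto perfect (proj₂ (depth v)))

  vertex-injective : ∀ {p q} → vertex p ≡ vertex q → p ≡ q
  vertex-injective = embed-injective top perfect

  address-vertex : ∀ p → address (vertex p) ≡ p
  address-vertex p = vertex-injective (vertex-address (vertex p))

  move : TreeAut k′ n → Vertex → Vertex
  move a v = vertex (act a (address v))

  move-Up : ∀ a → Up v w → Up (move a v) (move a w)
  move-Up {v} {w} a e = Parent⇒Up perfect (act-Parent a (Up⇒Parent top perfect {address v} {address w}
    (subst₂ Up (sym (vertex-address v)) (sym (vertex-address w)) e)))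

  move-~ : ∀ a → v ~ w → move a v ~ move a w
  move-~ a v~w with Up-or-Up v~w
  ... | inj₁ e = proj₁ (move-Up a e)
  ... | inj₂ e = ~-sym (proj₁ (move-Up a e))

  move-cancel : ∀ a b → (∀ p → act a (act b p) ≡ p) → ∀ v → move a (move b v) ≡ v
  move-cancel a b cancel v = trans
    (cong (vertex ∘ act a) (address-vertex (act b (address v))))
    (trans (cong vertex (cancel (address v))) (vertex-address v))

  induced : TreeAut k′ n → Automorphism G
  induced a = record
    { permutation = permutation (move a) (move (inverse a)) a-a⁻¹ a⁻¹-a
    ; preserves-~ = λ u v → mk⇔ (move-~ a)
        (λ e → subst₂ _~_ (a⁻¹-a u) (a⁻¹-a v) (move-~ (inverse a) e))
    }
    where
    a-a⁻¹ = move-cancel a (inverse a) (act-inverseʳ a)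
    a⁻¹-a = move-cancel (inverse a) a (act-inverseˡ a)

  distinguishing⇒rigid : {c : Coloring G d} → Distinguishing G c → Rigid (c ∘ vertex)
  distinguishing⇒rigid {c = c} dist a pres p = vertex-injective
    (trans (cong (vertex ∘ act a) (sym (address-vertex p))) (dist (induced a) preserves (vertex p)))
    where
    preserves : PreservesColors G c (induced a)
    preserves v = trans (pres (address v)) (cong c (vertex-address v))

  -- Degrees decide: the image of the root has degree k, while any other vertex has degree 1 or k +
  -- 1, and k is at least 2.
  fixes-root : ∀ φ → _·_ G φ r ≡ r
  fixes-root φ with (_·_ G φ r) ≟ r
  ... | yes eq = eq
  ... | no φr≢r = contradiction k<k (<-irrefl refl)
    where
    open ≤-Reasoning
    φr = _·_ G φ r
    ¬leaf : ¬ Leaf G φr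
    ¬leaf isLeaf = <⇒≱ (s≤s 1≤k₁) (begin
      k′          ≡⟨ root-degree ⟨
      degree G r  ≤⟨ degree-≤ φ r ⟩
      degree G φr ≡⟨ isLeaf ⟩
      1           ∎)
    k<k : k′ < k′
    k<k = begin
      suc k′                            ≡⟨ internal-degree φr φr≢r ¬leaf ⟨
      degree G φr                       ≤⟨ degree-≤ (opposite φ) φr ⟩
      degree G (_·_ G (opposite φ) φr)  ≡⟨ cong (degree G) (inverseˡ (Automorphism.permutation φ)) ⟩
      degree G r                        ≡⟨ root-degree ⟩
      k′                                ∎

  rigid⇒distinguishing : {c : Coloring G d} → Rigid (c ∘ vertex) → Distinguishing G c
  rigid⇒distinguishing {c = c} rigid φ pres v
    with a , eq ← restrict φ (fixes-root φ) perfect perfect (fixes-root φ) = begin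
    _·_ G φ v                  ≡⟨ cong (_·_ G φ) (vertex-address v) ⟨
    _·_ G φ (vertex (address v)) ≡⟨ eq (address v) ⟨
    vertex (act a (address v)) ≡⟨ cong vertex (rigid a (λ p → trans (cong c (eq p)) (pres (vertex p))) (address v)) ⟩
    vertex (address v)         ≡⟨ vertex-address v ⟩
    v                          ∎
    where open ≡-Reasoning

  positions : Permutation (size k′ n) order
  positions = permutation (vertex ∘ decode k′ n) (encode ∘ address)
    (λ v → trans (cong vertex (decode-encode (address v))) (vertex-address v))
    (λ x → trans (cong encode (address-vertex (decode k′ n x))) (encode-decode k′ n x))

  paint-size : (c : Coloring G d) (i : Fin d) → ∣ ∁ (colorClass G c i) ∣ ≡ cost i (c ∘ vertex)
  paint-size c i = trans (∣∁-tabulate∣ (λ v → does (c v ≟ i)))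
    (trans (sum-permute (mismatch i ∘ c) positions) (sym (total-decode n (mismatch i ∘ c ∘ vertex))))

  module _ {x : ℕ} (economical : Economical k′ d n x) where

    private
      c′ = proj₁ economical

    economical-coloring : Coloring G (suc d)
    economical-coloring = c′ ∘ address

    economical-distinguishing : Distinguishing G economical-coloring
    economical-distinguishing = rigid⇒distinguishing
      (Rigid-cong (λ p → cong c′ (sym (address-vertex p))) (proj₁ (proj₂ economical)))

    economical-size : ∣ ∁ (colorClass G economical-coloring zero) ∣ ≡ x
    economical-size = trans (paint-size economical-coloring zero) (trans
      (total-cong n (λ p → cong (mismatch zero ∘ c′) (address-vertex p))) (proj₂ (proj₂ economical)))

  paintCost : ∀ {x} → (∀ i (c : Position k′ n → Fin (suc d)) → Rigid c → x ≤ cost i c) →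
    Economical k′ d n x → IsPaintCost G (suc d) x
  paintCost {x = x} lower economical =
    (economical-coloring economical , economical-distinguishing economical , zero , economical-size economical) ,
    λ y (c , dist , i , size≡y) → ≤-trans (lower i (c ∘ vertex) (distinguishing⇒rigid dist))
      (≤-reflexive (trans (sym (paint-size c i)) size≡y))

  painted-fixing : (c : Coloring G d) (i : Fin d) → Distinguishing G c → Fixing G (∁ (colorClass G c i))
  painted-fixing c i dist φ fixes = dist φ pres
    where
    painted-fixed : c v ≢ i → _·_ G φ v ≡ v
    painted-fixed c≢i = fixes _ (x∉p⇒x∈∁p (c≢i ∘ ∈-comprehension⁻ (λ v → c v ≟ i)))
    pres : PreservesColors G c φ
    pres v with c v ≟ i
    ... | no c≢i = cong c (painted-fixed c≢i)
    ... | yes c≡i with c (_·_ G φ v) ≟ i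
    ...   | yes c′≡i = trans c′≡i (sym c≡i)
    -- The image of v is painted, hence fixed, so by injectivity it is v itself.
    ...   | no c′≢i = cong c (·-injective φ (painted-fixed c′≢i))

  fixing⇒coloring : (S : Subset order) → Fixing G S →
    Σ[ c ∈ Coloring G (suc order) ] Distinguishing G c × ∣ ∁ (colorClass G c zero) ∣ ≡ ∣ S ∣
  fixing⇒coloring S fixing = c , (λ φ pres → fixing φ (λ v v∈S → fixed (pres v) v∈S)) , cong ∣_∣ ∁≡S
    where
    c : Coloring G (suc order)
    -- Each vertex of S gets a colour of its own, hence order + 1 colours.
    c v = if lookup S v then suc v else zero
    fixed : c w ≡ c v → v ∈ S → w ≡ v
    fixed {w} {v} eq v∈S rewrite []=⇒lookup v∈S with lookup S w
    ... | true = suc-injective eq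
    outside-zero : ∀ v → not (does (c v ≟ zero)) ≡ lookup S v
    outside-zero v with lookup S v
    ... | true  = refl
    ... | false = refl
    ∁≡S : ∁ (colorClass G c zero) ≡ S
    ∁≡S = trans (sym (tabulate-∘ not (λ v → does (c v ≟ zero))))
      (trans (tabulate-cong outside-zero) (tabulate∘lookup S))

  -- The lower bound is required for every number of colours, because the colouring made from a
  -- fixing set uses order + 1 of them.
  isFix : ∀ {x} → (∀ {d} i (c : Position k′ n → Fin d) → Rigid c → x ≤ cost i c) →
    Economical k′ d n x → IsFix G x
  isFix {x = x} lower economical =
    (_ , painted-fixing (economical-coloring economical) zero (economical-distinguishing economical) ,
      economical-size economical) ,
    λ y (S , fixing , size≡y) → let c , dist , eq = fixing⇒coloring S fixing in
      ≤-trans (lower zero (c ∘ vertex) (distinguishing⇒rigid dist))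
        (≤-reflexive (trans (sym (paint-size c zero)) (trans eq size≡y)))

-- Spectrum and ratio

-- Here j is k - 1, x is k ^ m, and the inner product with 1 is the unfolded k ^ 2.
depth-3-cost : ∀ j x → x * (suc j * (suc j * j) + j) ≡ j * (suc j * (suc j * 1) + 1) * x
depth-3-cost = solve-∀

depth-3-cost′ : ∀ j x → x * (suc j * j + j * suc (suc j * j)) ≡ j * (suc j * (suc j * 1) + 1) * x
depth-3-cost′ = solve-∀

-- This splits off the fixing number; the positive rest x * j shows that k + 1 colours do not attain
-- it from depth 3 on.
depth-3-cost″ : ∀ j x → j * (suc j * (suc j * 1) + 1) * x ≡ suc j * (suc j * x) * j + x * j
depth-3-cost″ = solve-∀

square-expand : ∀ j → (2 + j) * ((2 + j) * 1) ≡ 2 * (2 + j) + (2 + j) * j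
square-expand = solve-∀

-- Here e is Fix - k, and Fdist is k + 1, as happens at depth 2.
ratio-numerator-1 : ∀ e k → e ℤ.+ k ℤ.- (k ℤ.+ ℤ.+ 1) ℤ.+ ℤ.+ 2 ≡ ℤ.+ 1 ℤ.+ e
ratio-numerator-1 = ℤ-Solver.solve-∀

ratio-numerator-2 : ∀ e k → e ℤ.+ k ℤ.- (k ℤ.+ ℤ.+ 2) ℤ.+ ℤ.+ 2 ≡ e
ratio-numerator-2 = ℤ-Solver.solve-∀

ratio-numerator-star : ∀ j → j ℤ.+ ℤ.+ 0 ℤ.- (ℤ.+ 1 ℤ.+ j ℤ.+ ℤ.+ 0) ℤ.+ ℤ.+ 2 ≡ ℤ.+ 1
ratio-numerator-star = ℤ-Solver.solve-∀

Pointwise-replicate : ∀ {P : ℕ → ℕ → Set} {y} m (f : ℕ → ℕ) → (∀ j → P (f j) y) →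
  Pointwise P (applyUpTo f m) (replicate m y)
Pointwise-replicate zero    f pf = []
Pointwise-replicate (suc m) f pf = pf 0 ∷ Pointwise-replicate m (f ∘ suc) (pf ∘ suc)

paintCostRatio : ∀ (G : Graph) {fix fdist dist y x} → IsFix G fix → IsFdist G fdist → IsDist G dist →
  fix + 2 ∸ dist ≡ suc y → ℤ.+ fix ℤ.- ℤ.+ fdist ℤ.+ ℤ.+ 2 ≡ x → IsPaintCostRatio G (x / suc y)
paintCostRatio G {fix} {fdist} {dist} {y} {x} isFix isFdist isDist den num = record
  { isFix   = isFix
  ; isFdist = isFdist
  ; isDist  = isDist
  ; nonZero = nonZero
  ; isRatio = /-cong {x} {suc y} {ℤ.+ fix ℤ.- ℤ.+ fdist ℤ.+ ℤ.+ 2} {fix + 2 ∸ dist}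
      {{_}} {{nonZero}} (sym num) (sym den)
  }
  where
  nonZero : NonZero (fix + 2 ∸ dist)
  nonZero = subst NonZero (sym den) _

module Spectrum (G : Graph) {k₂ n₁ : ℕ} (tree : IsPerfectTree G (2 + k₂) (suc n₁)) where

  open PerfectTree G tree (s≤s z≤n)

  private
    k₁ k′ F : ℕ
    k₁ = suc k₂
    k′ = suc k₁
    F  = k′ ^ n₁ * k₁

  rainbow-economical : Economical k′ k₁ (suc n₁) (k′ ^ suc n₁ ∸ 1)
  rainbow-economical = rainbow (suc n₁) zero , rainbow-rigid (suc n₁) zero ,
    cong (_∸ 1) (trans (rainbow-cost (suc n₁) zero) (+-identityʳ _))

  dist : IsDist G k′
  dist = (economical-coloring rainbow-economical , economical-distinguishing rainbow-economical) ,
    λ d (c , distinguishing) → rigid⇒k≤colours n₁ (c ∘ vertex) (distinguishing⇒rigid distinguishing)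

  paintCost-k : IsPaintCost G (k′ + 0) (k′ ^ suc n₁ ∸ 1)
  paintCost-k = subst (λ d → IsPaintCost G d (k′ ^ suc n₁ ∸ 1)) (sym (+-identityʳ k′))
    (paintCost (λ i c rigid → ∸-monoˡ-≤ 1 (≤-trans (m≤m+n (k′ ^ suc n₁) _) (k-colours-cost≥ (suc n₁) i c rigid)))
      rainbow-economical)

  frugal : ∀ {d} → 2 + k′ ≤ suc d → Economical k′ d (suc n₁) F
  frugal {d} k+2≤d =
    subst (λ h → Economical k′ d h F) (+-comm n₁ 1) (k+2-colours-economical n₁ k+2≤d)

  fix : IsFix G F
  fix = isFix (rigid⇒cost≥ n₁) (frugal ≤-refl)

  paintCost-k+2 : ∀ j → IsPaintCost G (k′ + (2 + j)) F
  paintCost-k+2 j = paintCost (rigid⇒cost≥ n₁) (frugal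
    (≤-trans (≤-reflexive (+-comm 2 k′)) (+-monoʳ-≤ k′ (m≤m+n 2 j))))

  fdist : ∀ s → IsPaintCost G (k′ + s) F → (∀ o → o < s → ¬ IsPaintCost G (k′ + o) F) →
    IsFdist G (k′ + s)
  fdist s attained minimal = (F , attained , fix) , least
    where
    bound : ∀ o → IsPaintCost G (k′ + o) F → s ≤ o
    bound o cost with s ≤? o
    ... | yes s≤o = s≤o
    ... | no  s≰o = contradiction cost (minimal o (≰⇒> s≰o))
    least : ∀ j → ∃[ m ] IsPaintCost G j m × IsFix G m → k′ + s ≤ j
    -- A paint cost for j colours presupposes a distinguishing colouring, so j is at least k and can
    -- be written as k + o.
    least j (m , costⱼ@((c , distinguishing , _) , _) , fixₘ) =
      subst (k′ + s ≤_) (proj₂ o) (+-monoʳ-≤ k′ (bound (proj₁ o)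
        (subst₂ (IsPaintCost G) (sym (proj₂ o)) (Least-unique fixₘ fix) costⱼ)))
      where o = m≤n⇒∃[o]m+o≡n (proj₂ dist j (c , distinguishing))

  -- Since k ^ n is k ^ (n - 1) + F with F the fixing number, k ^ n - 1 exceeds F as soon as k ^ (n
  -- - 1) is at least 2.
  ¬paintCost-k : 1 ≤ n₁ → ¬ IsPaintCost G (k′ + 0) F
  ¬paintCost-k 1≤n₁ cost = contradiction (Least-unique paintCost-k cost) λ eq →
    <⇒≢ (F<k^n∸1) (sym eq)
    where
    open ≤-Reasoning
    F<k^n∸1 : F < k′ ^ suc n₁ ∸ 1
    F<k^n∸1 = ≤-trans (≤-reflexive (sym (m+n∸n≡m (suc F) 1))) (∸-monoˡ-≤ 1 (begin
      suc F + 1             ≡⟨ +-comm (suc F) 1 ⟩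
      2 + F                 ≤⟨ +-monoˡ-≤ F (begin
        2           ≤⟨ s≤s (s≤s z≤n) ⟩
        k′          ≡⟨ *-identityʳ k′ ⟨
        k′ ^ 1      ≤⟨ ^-monoʳ-≤ k′ 1≤n₁ ⟩
        k′ ^ n₁     ∎) ⟩
      k′ ^ n₁ + F           ≡⟨ cong (k′ ^ n₁ +_) (*-comm (k′ ^ n₁) k₁) ⟩
      k′ ^ suc n₁           ∎))

  spectrum : ∀ {l costs} → F + 2 ∸ k′ ≡ l → Pointwise (IsPaintCost G) (applyUpTo (k′ +_) l) costs →
    IsPaintCostSpectrum G k′ costs
  spectrum {costs = costs} eq isCosts = record
    { isDist  = dist
    ; isFix   = fix
    ; isCosts = subst (λ l → Pointwise (IsPaintCost G) (applyUpTo (k′ +_) l) costs) (sym eq) isCosts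
    }

  F+2∸k : ∀ {e} → F ≡ e + k′ → F + 2 ∸ k′ ≡ 2 + e
  F+2∸k {e} eq = trans (cong (λ f → f + 2 ∸ k′) eq)
    (trans (cong (_∸ k′) (+-comm (e + k′) 2)) (m+n∸n≡m (2 + e) k′))

-- The cases of depth 1, 2 and at least 3

star : (G : Graph) {k₂ : ℕ} → IsPerfectTree G (2 + k₂) 1 →
  IsPaintCostSpectrum G (2 + k₂) (suc k₂ ∷ []) × IsPaintCostRatio G 1ℚ
star G {k₂} tree =
  spectrum den (subst (IsPaintCost G (k′ + 0)) k^1∸1≡k₁ paintCost-k ∷ []) ,
  paintCostRatio G fix (fdist 0 attained λ _ ()) dist den (ratio-numerator-star (ℤ.+ k₁))
  where
  open Spectrum G tree
  k₁ k′ : ℕ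
  k₁ = suc k₂
  k′ = suc k₁
  k^1∸1≡k₁ : k′ ^ 1 ∸ 1 ≡ k₁
  k^1∸1≡k₁ = cong (_∸ 1) (*-identityʳ k′)
  den : k₁ + 0 + 2 ∸ k′ ≡ 1
  den = trans (cong (λ f → f + 2 ∸ k′) (+-identityʳ k₁))
    (trans (cong (_∸ k′) (+-suc k₁ 1)) (m+n∸m≡n k′ 1))
  attained : IsPaintCost G (k′ + 0) (k₁ + 0)
  attained = subst (IsPaintCost G (k′ + 0)) (trans k^1∸1≡k₁ (sym (+-identityʳ k₁))) paintCost-k

depth-two : (G : Graph) {k₂ : ℕ} → IsPerfectTree G (2 + k₂) 2 → let k = 2 + k₂ in
  IsPaintCostSpectrum G k (k ^ 2 ∸ 1 ∷ replicate (1 + (k ^ 2 ∸ 2 * k)) (k * (k ∸ 1)))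
  × IsPaintCostRatio G (ℤ.+ (1 + (k ^ 2 ∸ 2 * k)) / (2 + (k ^ 2 ∸ 2 * k)))
depth-two G {k₂} tree =
  spectrum (F+2∸k F≡) (paintCost-k ∷ Pointwise-replicate (1 + e) (λ j → k′ + suc j) paintCost-k+1) ,
  paintCostRatio G fix (fdist 1 (subst (IsPaintCost G (k′ + 1)) (sym F≡k*k₁) (paintCost-k+1 0)) minimal) dist
    (F+2∸k F≡)
    (trans (cong (λ f → ℤ.+ f ℤ.- ℤ.+ (k′ + 1) ℤ.+ ℤ.+ 2) F≡) (ratio-numerator-1 (ℤ.+ e) (ℤ.+ k′)))
  where
  open Spectrum G tree
  open PerfectTree G tree (s≤s z≤n)
  k₁ k′ e : ℕ
  k₁ = suc k₂
  k′ = suc k₁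
  e = k′ ^ 2 ∸ 2 * k′
  F≡k*k₁ : k′ ^ 1 * k₁ ≡ k′ * k₁
  F≡k*k₁ = cong (_* k₁) (*-identityʳ k′)
  e≡ : e ≡ k′ * k₂
  e≡ = trans (cong (_∸ 2 * k′) (square-expand k₂)) (m+n∸m≡n (2 * k′) (k′ * k₂))
  F≡ : k′ ^ 1 * k₁ ≡ e + k′
  F≡ = trans F≡k*k₁ (trans (*-suc k′ k₂) (trans (+-comm k′ (k′ * k₂)) (cong (_+ k′) (sym e≡))))
  paintCost-k+1 : ∀ j → IsPaintCost G (k′ + suc j) (k′ * k₁)
  paintCost-k+1 j = paintCost
    (λ i c rigid → subst (_≤ cost i c) F≡k*k₁ (rigid⇒cost≥ 1 i c rigid))
    (depth-2-economical (≤-trans (≤-reflexive (+-comm 1 k′)) (+-monoʳ-≤ k′ (s≤s z≤n))))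
  minimal : ∀ o → o < 1 → ¬ IsPaintCost G (k′ + o) (k′ ^ 1 * k₁)
  minimal zero _ = ¬paintCost-k (s≤s z≤n)
  minimal (suc _) (s≤s ())

depth-three : (G : Graph) {k₂ : ℕ} (m : ℕ) → IsPerfectTree G (2 + k₂) (3 + m) →
  let k = 2 + k₂ ; F = k ^ (2 + m) * (k ∸ 1) in
  IsPaintCostSpectrum G k
    (k ^ (3 + m) ∸ 1 ∷ (k ∸ 1) * (k ^ 2 + 1) * k ^ m ∷ replicate (F ∸ k) F)
  × IsPaintCostRatio G (ℤ.+ (F ∸ k) / (2 + (F ∸ k)))
depth-three G {k₂} m tree =
  spectrum (F+2∸k F≡) (paintCost-k ∷ paintCost-k+1 ∷
    Pointwise-replicate e (λ j → k′ + suc (suc j)) paintCost-k+2) ,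
  paintCostRatio G fix (fdist 2 (paintCost-k+2 0) minimal) dist (F+2∸k F≡)
    (trans (cong (λ f → ℤ.+ f ℤ.- ℤ.+ (k′ + 2) ℤ.+ ℤ.+ 2) F≡) (ratio-numerator-2 (ℤ.+ e) (ℤ.+ k′)))
  where
  open Spectrum G tree
  open PerfectTree G tree (s≤s z≤n)
  k₁ k′ F e X : ℕ
  k₁ = suc k₂
  k′ = suc k₁
  F = k′ ^ (2 + m) * k₁
  e = F ∸ k′
  X = k₁ * (k′ ^ 2 + 1) * k′ ^ m
  k≤F : k′ ≤ F
  k≤F = begin
    k′                ≡⟨ *-identityʳ k′ ⟨
    k′ ^ 1            ≤⟨ ^-monoʳ-≤ k′ {1} {2 + m} (s≤s z≤n) ⟩
    k′ ^ (2 + m)      ≤⟨ m≤m*n (k′ ^ (2 + m)) k₁ ⟩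
    k′ ^ (2 + m) * k₁ ∎
    where open ≤-Reasoning
  F≡ : F ≡ e + k′
  F≡ = sym (m∸n+n≡m k≤F)
  lower : ∀ i (c : Position k′ (3 + m) → Fin (suc k′)) → Rigid c → X ≤ cost i c
  lower = subst (λ h → ∀ i (c : Position k′ h → Fin (suc k′)) → Rigid c → X ≤ cost i c) (+-comm m 3)
    (λ i c rigid → subst (_≤ cost i c) (depth-3-cost k₁ (k′ ^ m)) (k+1-colours-cost≥ m i c rigid))
  economical : Economical k′ k′ (3 + m) X
  economical = subst₂ (Economical k′ k′) (+-comm m 3) (depth-3-cost′ k₁ (k′ ^ m))
    (k+1-colours-economical ≤-refl m)
  paintCost-k+1 : IsPaintCost G (k′ + 1) X
  paintCost-k+1 = subst (λ d → IsPaintCost G d X) (+-comm 1 k′) (paintCost lower economical)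
  F<X : F < X
  F<X = subst (F <_) (sym (depth-3-cost″ k₁ (k′ ^ m)))
    (m<m+n F (*-mono-≤ (m^n>0 k′ m) (s≤s {n = k₂} z≤n)))
  minimal : ∀ o → o < 2 → ¬ IsPaintCost G (k′ + o) F
  minimal zero          _ = ¬paintCost-k (s≤s z≤n)
  minimal (suc zero)    _ = λ cost → <⇒≢ F<X (Least-unique cost paintCost-k+1)
  minimal (suc (suc _)) (s≤s (s≤s ()))

open import Data.Integer using (+_)

theorem4 : ∀ (k n : ℕ) → 2 ≤ k → 1 ≤ n → (T : Graph) → IsPerfectTree T k n →
    (n ≡ 1 →
    IsPaintCostSpectrum T k (k ∸ 1 ∷ [])
    × IsPaintCostRatio T 1ℚ)
    × (n ≡ 2 →
    IsPaintCostSpectrum T k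
    (k ^ 2 ∸ 1 ∷ replicate (1 + (k ^ 2 ∸ 2 * k)) (k * (k ∸ 1)))
    × IsPaintCostRatio T (+ (1 + (k ^ 2 ∸ 2 * k)) / (2 + (k ^ 2 ∸ 2 * k))))
    × (3 ≤ n →
    IsPaintCostSpectrum T k
    (k ^ n ∸ 1 ∷ (k ∸ 1) * (k ^ 2 + 1) * k ^ (n ∸ 3)
    ∷ replicate (k ^ (n ∸ 1) * (k ∸ 1) ∸ k) (k ^ (n ∸ 1) * (k ∸ 1)))
    × IsPaintCostRatio T
    (+ (k ^ (n ∸ 1) * (k ∸ 1) ∸ k) / (2 + (k ^ (n ∸ 1) * (k ∸ 1) ∸ k))))
theorem4 (suc (suc k₂)) n (s≤s (s≤s z≤n)) _ T tree =
  (λ n≡1 → star T (subst (IsPerfectTree T (2 + k₂)) n≡1 tree)) ,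
  (λ n≡2 → depth-two T (subst (IsPerfectTree T (2 + k₂)) n≡2 tree)) ,
  λ { (s≤s (s≤s (s≤s {n = m} z≤n))) → depth-three T m tree }
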